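{- Let $d$ be the dimension, $D=\binom{d+1}{2}$, let $G=(V,E)$ be a graph with a multiset $R$ of vertices of $V$, and let $p^\circ:R\to\mathbb{R}^d$. Then there exists $b:E\to Gr(2,\mathbb{R}^{d+1})$ such that the $d$-dimensional pinned body-bar framework $(G,R;b,p^\circ)$ is infinitesimally rigid if and only if $$|\delta_G(\mathcal{P})|\ \ge\ D|\mathcal{P}|-\sum_{X\in\mathcal{P},\,R_X\ne\emptyset}\ \sum_{i=1}^{d_X+1}(d-i+1)$$ for every partition $\mathcal{P}$ of the vertex set $V$ (into non-empty subsets), where $d_X$ denotes the dimension of the affine span of $p^\circ(R_X)$.
   Context: Graphs are finite and undirected. The multiset $R$ is an indexed family of vertices (elements with different indices are different elements of $R$); $R_v=\{r\in R\mid r=v\}$ for $v\in V$ and $R_X=\{r\in R\mid r\in X\}$ for $X\subseteq V$. For a partition $\mathcal{P}$ of $V$, $|\mathcal{P}|$ is the number of parts and $\delta_G(\mathcal{P})$ is the set of edges of $G$ connecting two distinct parts. $Gr(2,\mathbb{R}^{d+1})$ is the Grassmannian of $2$-dimensional linear subspaces, identified via the Plücker embedding with the set of classes $[v_1\wedge v_2]\in\mathbb{P}(\bigwedge^2\mathbb{R}^{d+1})$ of nonzero decomposable elements; $b_e$ denotes a representative vector in $\bigwedge^2\mathbb{R}^{d+1}$ of $b(e)$. For $a\in\bigwedge^{d-1}\mathbb{R}^{d+1}$ and $c\in\bigwedge^2\mathbb{R}^{d+1}$, $\langle a,c\rangle$ denotes the standard Euclidean inner product $\langle a,*c\rangle$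 of $a$ with the Hodge dual of $c$. A $d$-dimensional pinned body-bar framework is a tuple $(G,R;b,p^\circ)$ with $b:E\to Gr(2,\mathbb{R}^{d+1})$, $e\mapsto[b_e]$, and $p^\circ:R\to\mathbb{R}^d$ (the body of $v$ is pinned at $p^\circ(r)$ for each $r\in R_v$). An infinitesimal motion is a map $m:V\to\bigwedge^{d-1}\mathbb{R}^{d+1}$ with $\langle m(u)-m(v),b_e\rangle=0$ for all $e=uv\in E$, and, for all $v\in V$ and $r\in R_v$, $\langle m(v),(p^\circ(r),1)\wedge(q,1)\rangle=0$ for every $q\in\mathbb{R}^d$. The framework is infinitesimally rigid if it has no nonzero infinitesimal motion. -}

module Defs where

open import Level using (Level; _⊔_) renaming (suc to lsuc)
open import Algebra.Bundles using (CommutativeRing; Semiring)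
open import Algebra.Structures using (IsCommutativeRing)
open import Data.Bool.Base using (if_then_else_)
import Data.Bool.Properties as Bool
open import Data.Fin.Base using (Fin; toℕ; fromℕ)
import Data.Fin.Properties as Fin
open import Data.Fin.Subset using (Subset; inside; outside; ⊤; ∁; ⁅_⁆; ∣_∣; _∈_; Nonempty)
open import Data.Fin.Subset.Properties using (_∈?_)
open import Data.List.Base using (allFin; filter; length)
open import Data.Nat.Base as ℕ using (ℕ; zero; suc; _∸_; NonZero)
open import Data.Nat.Combinatorics using (_C_)
import Data.Nat.Properties as ℕ
open import Data.Product using (Σ; ∃; ∃!; _×_; _,_; proj₁; proj₂)
open import Data.Vec.Base using ([]; _∷_)
import Data.Vec.Properties as Vec
open import Data.Vec.Functional using (Vector; insertAt)
open import Function.Base using (_∘_)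
open import Relation.Binary.Bundles using (Setoid)
open import Relation.Binary.PropositionalEquality using (_≡_; _≢_)
open import Relation.Binary.Structures using (IsDecTotalOrder)
open import Relation.Nullary using (¬_; Dec; does)
open import Relation.Nullary.Decidable using (¬?)
open import Relation.Unary using (Pred)
import Algebra.Definitions.RawSemiring as RawSemiringDefs
import Algebra.Properties.Monoid.Sum as MonoidSum
import Relation.Binary.Reasoning.Setoid as SetoidReasoning

-- The classical axioms for ℝ, which determine it up to isomorphism. As usual
-- for this axiomatization the order is total and decidable, and every
-- inhabited predicate that is bounded above has a supremum.
record CompleteOrderedField c ℓ₁ ℓ₂ : Set (lsuc (c ⊔ ℓ₁ ⊔ ℓ₂)) where
  infix  4 _≈_ _≤_
  infixl 7 _*_
  infixl 6 _+_
  infix  8 -_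
  field
    Carrier           : Set c
    _≈_               : Carrier → Carrier → Set ℓ₁
    _≤_               : Carrier → Carrier → Set ℓ₂
    _+_ _*_           : Carrier → Carrier → Carrier
    -_                : Carrier → Carrier
    0# 1#             : Carrier
    isCommutativeRing : IsCommutativeRing _≈_ _+_ _*_ -_ 0# 1#
    isDecTotalOrder   : IsDecTotalOrder _≈_ _≤_
    1≉0               : ¬ (1# ≈ 0#)
    inverse           : ∀ x → ¬ (x ≈ 0#) → ∃ λ y → x * y ≈ 1#
    +-monoˡ-≤         : ∀ z {x y} → x ≤ y → x + z ≤ y + z
    *-nonNegative     : ∀ {x y} → 0# ≤ x → 0# ≤ y → 0# ≤ x * y

  UpperBound : ∀ {p} → Pred Carrier p → Carrier → Set (c ⊔ ℓ₂ ⊔ p)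
  UpperBound P u = ∀ x → P x → x ≤ u

  field
    supremum : (P : Pred Carrier (c ⊔ ℓ₁ ⊔ ℓ₂)) → ∃ P → ∃ (UpperBound P) →
               ∃ λ s → UpperBound P s × (∀ u → UpperBound P u → s ≤ u)

  commutativeRing : CommutativeRing c ℓ₁
  commutativeRing = record { isCommutativeRing = isCommutativeRing }

-- Parallel edges and loops are allowed. The order of the two ends of an edge
-- is an artefact of the encoding; nothing below depends on it.
record Graph : Set where
  field
    #V   : ℕ
    #E   : ℕ
    ends : Fin #E → Fin #V × Fin #V

  V E : Set
  V = Fin #V
  E = Fin #E

  end₁ end₂ : E → V
  end₁ = proj₁ ∘ ends
  end₂ = proj₂ ∘ ends

record Partition (n : ℕ) : Set where
  field
    size     : ℕ
    part     : Fin size → Subset n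
    nonempty : ∀ i → Nonempty (part i)
    unique   : ∀ v → ∃! _≡_ λ i → v ∈ part i

  partOf : Fin n → Fin size
  partOf v = proj₁ (unique v)

module _ (G : Graph) where
  open Graph G

  -- ∣δ_G(𝒫)∣
  ∣δ∣ : Partition #V → ℕ
  ∣δ∣ 𝒫 = length (filter (λ e → ¬? (partOf (end₁ e) Fin.≟ partOf (end₂ e))) (allFin #E))
    where open Partition 𝒫

-- A multiset of vertices is a family R indexed by Fin ρ, and R_X is
-- represented by the set of indices r with R r ∈ X.
module _ {n ρ : ℕ} (R : Fin ρ → Fin n) (X : Subset n) where

  R_X≢∅ : Set
  R_X≢∅ = ∃ λ r → R r ∈ X

  R_X≢∅? : Dec R_X≢∅
  R_X≢∅? = Fin.any? λ r → R r ∈? X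

private module ℕSum = MonoidSum ℕ.+-0-monoid

-- Σ_{i=1}^{k+1} (d - i + 1), with the index shifted to start at 0. Only
-- k ≤ d occurs, so the subtraction is never truncated.
pinRank : ℕ → ℕ → ℕ
pinRank d k = ℕSum.sum {suc k} λ i → d ∸ toℕ i

-- Σ_{X ∈ 𝒫, R_X ≠ ∅} Σ_{i=1}^{d_X+1} (d - i + 1)
totalPinRank : ∀ {n ρ} → ℕ → (Fin ρ → Fin n) → (𝒫 : Partition n) →
               (Fin (Partition.size 𝒫) → ℕ) → ℕ
totalPinRank d R 𝒫 dim = ℕSum.sum λ i →
  if does (R_X≢∅? R (part i)) then pinRank d (dim i) else 0
  where open Partition 𝒫

module Framework {c ℓ₁ ℓ₂ : Level} (ℝ : CompleteOrderedField c ℓ₁ ℓ₂) where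

  open CompleteOrderedField ℝ using (1≉0; inverse)
  open CommutativeRing (CompleteOrderedField.commutativeRing ℝ)
  open MonoidSum +-monoid using (sum)
  open RawSemiringDefs (Semiring.rawSemiring semiring) using (_^_)

  Point : ℕ → Set c
  Point d = Vector Carrier d

  AffineSpan : ∀ {d p} → Pred (Point d) p → Pred (Point d) (c ⊔ ℓ₁ ⊔ p)
  AffineSpan S x =
    ∃ λ k → Σ (Fin k → Point _) λ q → Σ (Fin k → Carrier) λ λs →
      (∀ j → S (q j)) × sum λs ≈ 1# × (∀ t → sum (λ j → λs j * q j t) ≈ x t)

  AffinelyIndependent : ∀ {d k} → (Fin k → Point d) → Set (c ⊔ ℓ₁)
  AffinelyIndependent q =
    ∀ λs → sum λs ≈ 0# → (∀ t → sum (λ j → λs j * q j t) ≈ 0#) → ∀ j → λs j ≈ 0#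

  Range : ∀ {d k} → (Fin k → Point d) → Pred (Point d) ℓ₁
  Range q x = ∃ λ j → ∀ t → q j t ≈ x t

  -- The affine subspace A has an affine basis of k + 1 points.
  HasDimension : ∀ {d p} → Pred (Point d) p → ℕ → Set (c ⊔ ℓ₁ ⊔ p)
  HasDimension A k =
    ∃ λ (q : Fin (suc k) → Point _) →
      (∀ j → A (q j)) × AffinelyIndependent q × (∀ x → A x → AffineSpan (Range q) x)

  -- p°(R_X)
  Image : ∀ {n d ρ} (R : Fin ρ → Fin n) → (Fin ρ → Point d) → Subset n → Pred (Point d) ℓ₁
  Image R p° X x = ∃ λ r → R r ∈ X × (∀ t → p° r t ≈ x t)

  -- The exterior algebra of ℝⁿ, in coordinates with respect to the basis
  -- e_I = e_{i₁} ∧ … ∧ e_{iₖ}, I = {i₁ < … < iₖ}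
  Λ : ℕ → Set c
  Λ n = Subset n → Carrier

  e : ∀ {n} → Subset n → Λ n
  e I J = if does (Vec.≡-dec Bool._≟_ I J) then 1# else 0#

  vector : ∀ {n} → Vector Carrier n → Λ n
  vector v I = sum λ i → v i * e ⁅ i ⁆ I

  -- The grade involution: multiplication by (-1)ᵏ on ⋀ᵏ.
  involute : ∀ {n} → Λ n → Λ n
  involute a I = (- 1#) ^ ∣ I ∣ * a I

  -- Write a = a₀ + e₀ ∧ a₁ and b = b₀ + e₀ ∧ b₁, where e₀ does not occur in
  -- a₀, a₁, b₀, b₁. Then a ∧ b = a₀ ∧ b₀ + e₀ ∧ (a₁ ∧ b₀ + involute a₀ ∧ b₁).
  infixr 7 _∧_
  _∧_ : ∀ {n} → Λ n → Λ n → Λ n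
  _∧_ {zero}  a b []            = a [] * b []
  _∧_ {suc n} a b (outside ∷ I) = ((a ∘ (outside ∷_)) ∧ (b ∘ (outside ∷_))) I
  _∧_ {suc n} a b (inside  ∷ I) = ((a ∘ (inside ∷_)) ∧ (b ∘ (outside ∷_))) I
                                + (involute (a ∘ (outside ∷_)) ∧ (b ∘ (inside ∷_))) I

  -- The Hodge dual: ⋆ e_I = ± e_{∁ I}, with the sign for which
  -- e_I ∧ ⋆ e_I = e_⊤; this sign is the ⊤-coordinate of e_I ∧ e_{∁ I}.
  ⋆_ : ∀ {n} → Λ n → Λ n
  (⋆ a) J = (e (∁ J) ∧ e J) ⊤ * a (∁ J)

  sumOverSubsets : ∀ n → (Subset n → Carrier) → Carrier
  sumOverSubsets zero    f = f []
  sumOverSubsets (suc n) f = sumOverSubsets n (f ∘ (outside ∷_)) + sumOverSubsets n (f ∘ (inside ∷_))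

  inner : ∀ {n} → Λ n → Λ n → Carrier
  inner {n} a b = sumOverSubsets n λ I → a I * b I

  ⟨_,_⟩ : ∀ {n} → Λ n → Λ n → Carrier
  ⟨ a , b ⟩ = inner a (⋆ b)

  IsZero : ∀ {n} → Λ n → Set ℓ₁
  IsZero a = ∀ I → a I ≈ 0#

  infixl 6 _⊖_
  _⊖_ : ∀ {n} → Λ n → Λ n → Λ n
  (a ⊖ b) I = a I - b I

  record ⋀ (k n : ℕ) : Set (c ⊔ ℓ₁) where
    field
      element     : Λ n
      homogeneous : ∀ I → ∣ I ∣ ≢ k → element I ≈ 0#
  open ⋀ public

  -- Gr(2, ℝⁿ) under the Plücker embedding is the setoid Gr₂ n of nonzero
  -- decomposable elements of ⋀² ℝⁿ up to nonzero scalars. A map from the discrete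
  -- edge set into it is a choice b_e of representatives; the motion equations
  -- are homogeneous in b_e, so they only depend on the classes.
  record Decomposable₂ (n : ℕ) : Set (c ⊔ ℓ₁) where
    field
      bivector : Λ n
      v₁ v₂    : Vector Carrier n
      factors  : ∀ I → bivector I ≈ (vector v₁ ∧ vector v₂) I
      nonzero  : ¬ IsZero bivector
  open Decomposable₂ public

  _∝_ : ∀ {n} → Λ n → Λ n → Set (c ⊔ ℓ₁)
  a ∝ b = ∃ λ s → ¬ (s ≈ 0#) × (∀ I → a I ≈ s * b I)

  ∝-refl : ∀ {n} {a : Λ n} → a ∝ a
  ∝-refl = 1# , 1≉0 , λ I → sym (*-identityˡ _)

  ∝-sym : ∀ {n} {a b : Λ n} → a ∝ b → b ∝ a
  ∝-sym {a = a} {b} (s , s≉0 , a≈sb) with inverse s s≉0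
  ... | t , st≈1 = t , t≉0 , λ I → begin
      b I            ≈⟨ *-identityˡ _ ⟨
      1# * b I       ≈⟨ *-congʳ (trans (sym st≈1) (*-comm s t)) ⟩
      (t * s) * b I  ≈⟨ *-assoc t s _ ⟩
      t * (s * b I)  ≈⟨ *-congˡ (a≈sb I) ⟨
      t * a I        ∎
    where
    open SetoidReasoning setoid
    t≉0 : ¬ (t ≈ 0#)
    t≉0 t≈0 = 1≉0 (trans (sym st≈1) (trans (*-congˡ t≈0) (zeroʳ s)))

  ∝-trans : ∀ {n} {a b d : Λ n} → a ∝ b → b ∝ d → a ∝ d
  ∝-trans {d = d} (s , s≉0 , a≈sb) (t , t≉0 , b≈td) =
    s * t , st≉0 , λ I → trans (a≈sb I) (trans (*-congˡ (b≈td I)) (sym (*-assoc s t _)))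
    where
    st≉0 : ¬ (s * t ≈ 0#)
    st≉0 st≈0 with inverse s s≉0
    ... | u , su≈1 = t≉0 (begin
      t            ≈⟨ *-identityˡ t ⟨
      1# * t       ≈⟨ *-congʳ (trans (sym su≈1) (*-comm s u)) ⟩
      (u * s) * t  ≈⟨ *-assoc u s t ⟩
      u * (s * t)  ≈⟨ *-congˡ st≈0 ⟩
      u * 0#       ≈⟨ zeroʳ u ⟩
      0#           ∎)
      where open SetoidReasoning setoid

  Gr₂ : ℕ → Setoid (c ⊔ ℓ₁) (c ⊔ ℓ₁)
  Gr₂ n = record
    { Carrier       = Decomposable₂ n
    ; _≈_           = λ a b → bivector a ∝ bivector b
    ; isEquivalence = record
      { refl = ∝-refl ; sym = ∝-sym ; trans = ∝-trans }
    }

  -- (x , 1)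
  homogenize : ∀ {d} → Point d → Vector Carrier (suc d)
  homogenize {d} x = insertAt x (fromℕ d) 1#

  module _ {d : ℕ} .{{_ : NonZero d}} (G : Graph) {ρ : ℕ} (R : Fin ρ → Graph.V G)
           (b : Graph.E G → Setoid.Carrier (Gr₂ (suc d))) (p° : Fin ρ → Point d) where
    open Graph G

    IsInfinitesimalMotion : (V → ⋀ (d ∸ 1) (suc d)) → Set (c ⊔ ℓ₁)
    IsInfinitesimalMotion m =
      (∀ i → ⟨ element (m (end₁ i)) ⊖ element (m (end₂ i)) , bivector (b i) ⟩ ≈ 0#) ×
      (∀ v r → R r ≡ v → ∀ (q : Point d) →
         ⟨ element (m v) , vector (homogenize (p° r)) ∧ vector (homogenize q) ⟩ ≈ 0#)

    InfinitesimallyRigid : Set (c ⊔ ℓ₁)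
    InfinitesimallyRigid =
      ¬ (∃ λ m → IsInfinitesimalMotion m × ¬ (∀ v → IsZero (element (m v))))

  -- The counting inequality for 𝒫, where d_X is any assignment giving, for
  -- each part X with R_X ≠ ∅, the dimension of the affine span of p°(R_X).
  -- Since |δ_G(𝒫)| ≥ 0, truncating the right-hand side at 0 is harmless.
  CountingCondition : ∀ {d} (G : Graph) {ρ} (R : Fin ρ → Graph.V G) (p° : Fin ρ → Point d) →
                      Partition (Graph.#V G) → Set (c ⊔ ℓ₁)
  CountingCondition {d} G R p° 𝒫 =
    ∀ (d_X : Fin size → ℕ) →
    (∀ i → R_X≢∅ R (part i) → HasDimension (AffineSpan (Image R p° (part i))) (d_X i)) →
    ∣δ∣ G 𝒫 ℕ.≥ (suc d C 2) ℕ.* size ∸ totalPinRank d R 𝒫 d_X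
    where open Partition 𝒫

{-# OPTIONS --safe #-}
-- Write a motion at v as the alternating form (x , y) ↦ ⟨ m v , x ∧ y ⟩. No genericity is needed: the bars can be
-- chosen among the coordinate bivectors e_i ∧ e_j, since Rado's theorem on independent transversals yields such a
-- choice killing all pinned motions as soon as, for every edge set F, the pinned motions that are constant along F
-- form a space of dimension at most |E \ F|. Such motions are constant on the components of F, and on a component X
-- they are the alternating forms on ℝ^(d+1) whose radical contains the pins of X. If f_1, …, f_t is a basis of the
-- linear forms vanishing on those pins, these are the combinations of the f_i ∧ f_j with i < j, so the dimension is
-- t (t - 1) / 2 = D - Σ_{i=1}^{d_X+1} (d - i + 1), and the condition on F is the inequality for the partition into
-- components. Conversely, for any bars, the motions that are constant on the parts of 𝒫 and compatible with the pins
-- form a space of dimension Σ_X t_X (t_X - 1) / 2 subject to |δ(𝒫)| equations, so rigidity forces the inequality.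
module Submission where

open import Defs
open import Data.Fin.Base using (Fin)
open import Data.Nat.Base using (ℕ; suc; NonZero)
open import Data.Product using (∃)
open import Function.Bundles using (_⇔_)
open import Relation.Binary.Bundles using (Setoid)

open import Level using (Level; _⊔_) renaming (suc to lsuc)
open import Algebra.Bundles using (CommutativeRing; Semiring)
import Algebra.Definitions.RawSemiring as RawSemiringDefs
import Algebra.Properties.CommutativeMonoid.Sum as CommutativeMonoidSum
import Algebra.Properties.Group as GroupProperties
import Algebra.Properties.Monoid.Mult as Mult
import Algebra.Properties.Ring as RingProperties
import Algebra.Properties.Semiring.Sum as SemiringSum
import Algebra.Solver.Ring as RingSolver
open import Algebra.Solver.Ring.AlmostCommutativeRing using (_-Raw-AlmostCommutative⟶_; fromCommutativeRing)
open import Data.Bool.Base using (if_then_else_)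
import Data.Bool.Properties as Bool
open import Data.Empty using () renaming (⊥ to Empty)
open import Data.Fin.Base using (zero; suc; punchIn; punchOut; toℕ; fromℕ; fromℕ<; inject; remQuot; combine)
import Data.Fin.Properties as Fin
open import Data.Fin.Subset using (Subset; inside; outside; ∁; ∣_∣; _∈_; _⊆_; _∪_; _∩_; ⊥; ⁅_⁆) renaming (⊤ to ⊤ˢ)
open import Data.Fin.Subset.Properties
  using (anySubset?; drop-there; _∈?_; x∈p∪q⁻; p⊆p∪q; q⊆p∪q; p∩q⊆p; p∩q⊆q; x∉p⇒x∈∁p; ∣⊥∣≡0; ∣∁p∣≡n∸∣p∣; ∣p∣≤n)
open import Data.Integer.Base as ℤ using (ℤ; +_; -[1+_]; +0)
import Data.Integer.Properties as ℤ
open import Data.List.Base as List using (List; []; _∷_; length; filter; allFin)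
import Data.List.Properties as List
open import Data.List.Membership.Propositional using () renaming (_∈_ to _∈ₗ_)
open import Data.List.Membership.Propositional.Properties using (∈-filter⁺; ∈-filter⁻; ∈-allFin)
import Data.List.Relation.Unary.Any as Any
import Data.List.Relation.Unary.Any.Properties as Any
import Data.Maybe.Base as Maybe
open import Data.Nat.Base as ℕ using (zero; z≤n; s≤s; _∸_)
open import Data.Nat.Combinatorics as Combinatorics using (nC1≡n; nCk+nC[k+1]≡[n+1]C[k+1])
import Data.Nat.Properties as ℕ
open import Data.Product using (∃₂; Σ; _×_; _,_; proj₁; proj₂)
open import Data.Product.Function.NonDependent.Propositional using (_×-↔_)
open import Data.Sum.Base using (_⊎_; inj₁; inj₂; [_,_]; [_,_]′)
open import Data.Sum.Function.Propositional using (_⊎-↔_)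
open import Data.Unit.Base using (⊤; tt)
open import Data.Vec.Base as Vec using ([]; _∷_; here; there)
open import Data.Vec.Functional using (Vector) renaming (_∷_ to _∷ᵥ_)
import Data.Vec.Functional.Properties as VecF
import Data.Vec.Properties as Vec
open import Function.Base using (_∘_; case_of_; id)
open import Function.Bundles using (_↔_; Inverse; mk↔ₛ′; mk⇔)
open import Function.Properties.Inverse using (↔-refl; ↔-sym; ↔-trans)
open import Relation.Binary.Core using (Rel)
open import Relation.Binary.Definitions using (Decidable; tri<; tri≈; tri>)
open import Relation.Binary.PropositionalEquality as ≡ using (_≡_; _≢_)
import Relation.Binary.Reasoning.Setoid as SetoidReasoning
open import Relation.Binary.Structures using (IsDecTotalOrder; IsEquivalence)
open import Relation.Nullary using (¬_; yes; no; does; contradiction)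
open import Relation.Nullary.Decidable using (¬?; decidable-stable; dec-true; dec-false; dec⇒maybe)
open import Relation.Unary using (Pred)
import Relation.Unary as Unary

-- Rado's theorem enters in its deficiency form. For a transversal that is independent throughout,
-- the forms attached to F must have rank at least |F|. Here the chosen forms have to separate the
-- points of a space of dimension t, so the condition is rank(F) ≥ t - |∁ F|: the common kernel of
-- all forms attached to F has dimension at most |∁ F|. Everything is therefore phrased through
-- solution spaces. The two directions bound the space of pinned forms on a part from opposite
-- sides. Necessity is handed `d_X` with an affine basis and needs many forms: the f_i ∧ f_j are
-- independent because they pair dually with the y_i ∧ y_j, where y is dual to f. Sufficiency needs
-- few forms: such a form is determined by its values on the pairs y_i, y_j. There `d_X` is produced
-- by extracting an affine basis from the pins, so that the counting condition can be applied.

private module ℕSum = CommutativeMonoidSum ℕ.+-0-commutativeMonoid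

-- Sums of natural numbers and triangular numbers.

sum-mono-≤ : ∀ {n} {f g : Fin n → ℕ} → (∀ i → f i ℕ.≤ g i) → ℕSum.sum f ℕ.≤ ℕSum.sum g
sum-mono-≤ {zero}  f≤g = z≤n
sum-mono-≤ {suc n} f≤g = ℕ.+-mono-≤ (f≤g zero) (sum-mono-≤ (f≤g ∘ suc))

sum-extend-≤ : ∀ {m n} (f : ℕ → ℕ) → m ℕ.≤ n → ℕSum.sum {m} (f ∘ toℕ) ℕ.≤ ℕSum.sum {n} (f ∘ toℕ)
sum-extend-≤ f z≤n       = z≤n
sum-extend-≤ f (s≤s m≤n) = ℕ.+-monoʳ-≤ (f 0) (sum-extend-≤ (f ∘ suc) m≤n)

sum-const : ∀ n k → ℕSum.sum {n} (λ _ → k) ≡ k ℕ.* n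
sum-const zero    k = ≡.sym (ℕ.*-zeroʳ k)
sum-const (suc n) k = ≡.trans (≡.cong (k ℕ.+_) (sum-const n k)) (≡.sym (ℕ.*-suc k n))

-- Bridge from degrees of freedom to the counting inequality: `f` will be the freedom that the pins
-- leave to each part, and `g` the pin rank of that part.
count-≤ : ∀ {size D δ} (f g : Fin size → ℕ) → (∀ i → D ℕ.≤ f i ℕ.+ g i) → ℕSum.sum f ℕ.≤ δ →
          D ℕ.* size ∸ ℕSum.sum g ℕ.≤ δ
count-≤ {size} {D} {δ} f g D≤ Σf≤δ = ℕ.m≤n+o⇒m∸n≤o _ (ℕSum.sum g) (begin
  D ℕ.* size                        ≡⟨ sum-const size D ⟨
  ℕSum.sum {size} (λ _ → D)         ≤⟨ sum-mono-≤ D≤ ⟩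
  ℕSum.sum (λ i → f i ℕ.+ g i)      ≡⟨ ℕSum.∑-distrib-+ f g ⟩
  ℕSum.sum f ℕ.+ ℕSum.sum g         ≤⟨ ℕ.+-monoˡ-≤ _ Σf≤δ ⟩
  δ ℕ.+ ℕSum.sum g                  ≡⟨ ℕ.+-comm δ _ ⟩
  ℕSum.sum g ℕ.+ δ                  ∎)
  where open ℕ.≤-Reasoning

-- The way back. The bound f + g ≤ D ensures that the truncated subtraction loses nothing.
count-≤⁻ : ∀ {size D δ} (f g : Fin size → ℕ) → (∀ i → f i ℕ.+ g i ℕ.≤ D) →
           D ℕ.* size ∸ ℕSum.sum g ℕ.≤ δ → ℕSum.sum f ℕ.≤ δ
count-≤⁻ {size} {D} f g ≤D ≤δ = ℕ.≤-trans (ℕ.m+n≤o⇒m≤o∸n _ (begin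
  ℕSum.sum f ℕ.+ ℕSum.sum g         ≡⟨ ℕSum.∑-distrib-+ f g ⟨
  ℕSum.sum (λ i → f i ℕ.+ g i)      ≤⟨ sum-mono-≤ ≤D ⟩
  ℕSum.sum {size} (λ _ → D)         ≡⟨ sum-const size D ⟩
  D ℕ.* size                        ∎)) ≤δ
  where open ℕ.≤-Reasoning

-- The binomial coefficient of `n` over 2, as a sum over the larger index of a pair, which matches
-- the shape of `Pair`.
triangle : ℕ → ℕ
triangle n = ℕSum.sum {n} toℕ

triangle-suc : ∀ n → triangle (suc n) ≡ n ℕ.+ triangle n
triangle-suc n = ≡.trans (ℕSum.∑-distrib-+ {n} (λ _ → 1) toℕ)
  (≡.cong (ℕ._+ triangle n) (≡.trans (sum-const n 1) (ℕ.*-identityˡ n)))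

triangle≡C2 : ∀ n → n Combinatorics.C 2 ≡ triangle n
triangle≡C2 zero    = ≡.refl
triangle≡C2 (suc n) = ≡.trans (≡.sym (nCk+nC[k+1]≡[n+1]C[k+1] n 1))
  (≡.trans (≡.cong₂ ℕ._+_ (nC1≡n n) (triangle≡C2 n)) (≡.sym (triangle-suc n)))

-- Removes the `s` longest rows of the triangle. For s + t = d + 1 these have lengths d ∸ i with i <
-- s, the terms of `pinRank`.
triangle-+ : ∀ s t → triangle (s ℕ.+ t) ≡ triangle t ℕ.+ ℕSum.sum {s} (λ i → s ℕ.+ t ∸ suc (toℕ i))
triangle-+ zero    t = ≡.sym (ℕ.+-identityʳ _)
triangle-+ (suc s) t = ≡.trans (triangle-suc (s ℕ.+ t)) (≡.trans (≡.cong (s ℕ.+ t ℕ.+_) (triangle-+ s t))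
  (≡.trans (≡.sym (ℕ.+-assoc (s ℕ.+ t) _ _)) (≡.trans (≡.cong (ℕ._+ Σs) (ℕ.+-comm (s ℕ.+ t) _)) (ℕ.+-assoc (triangle t) _ _))))
  where Σs = ℕSum.sum {s} (λ i → s ℕ.+ t ∸ suc (toℕ i))

-- Enumerations and cardinalities of finite sets.

Σ-enumerate : ∀ {n} {B : Fin n → Set} {f : Fin n → ℕ} → (∀ i → B i ↔ Fin (f i)) → Σ (Fin n) B ↔ Fin (ℕSum.sum f)
Σ-enumerate {zero}          B↔ = mk↔ₛ′ (λ ()) (λ ()) (λ ()) (λ ())
Σ-enumerate {suc n} {B} {f} B↔ =
  ↔-trans split (↔-trans (B↔ zero ⊎-↔ Σ-enumerate (B↔ ∘ suc)) (↔-sym Fin.+↔⊎))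
  where
  split : Σ (Fin (suc n)) B ↔ (B zero ⊎ Σ (Fin n) (B ∘ suc))
  split = mk↔ₛ′ (λ { (zero , b) → inj₁ b ; (suc i , b) → inj₂ (i , b) })
                [ (λ b → zero , b) , (λ (i , b) → suc i , b) ]′
                (λ { (inj₁ _) → ≡.refl ; (inj₂ _) → ≡.refl })
                (λ { (zero , _) → ≡.refl ; (suc _ , _) → ≡.refl })

-- The pairs i < j in Fin t, with j first.
Pair : ℕ → Set
Pair t = Σ (Fin t) (Fin ∘ toℕ)

Pair-enumerate : ∀ t → Pair t ↔ Fin (triangle t)
Pair-enumerate t = Σ-enumerate λ _ → ↔-refl

Subset-enumerate : ∀ n → ∃ λ N → Subset n ↔ Fin N
Subset-enumerate zero    = 1 , mk↔ₛ′ (λ _ → zero) (λ _ → []) (λ { zero → ≡.refl }) (λ { [] → ≡.refl })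
Subset-enumerate (suc n) with Subset-enumerate n
... | N , S↔N = N ℕ.+ N , ↔-trans split (↔-trans (S↔N ⊎-↔ S↔N) (↔-sym Fin.+↔⊎))
  where
  split : Subset (suc n) ↔ (Subset n ⊎ Subset n)
  split = mk↔ₛ′ (λ { (outside ∷ I) → inj₁ I ; (inside ∷ I) → inj₂ I })
                [ outside ∷_ , inside ∷_ ]′
                (λ { (inj₁ _) → ≡.refl ; (inj₂ _) → ≡.refl })
                (λ { (outside ∷ _) → ≡.refl ; (inside ∷ _) → ≡.refl })

-- Compares the list count in `∣δ∣` with the cardinality of a subset, later the complement of an
-- edge set.
∣filter∣≤∣∣ : ∀ {m a p} {A : Set a} {P : Pred A p} (P? : Unary.Decidable P) (f : Fin m → A) (S : Subset m) →
              (∀ i → P (f i) → i ∈ S) → length (filter P? (List.tabulate f)) ℕ.≤ ∣ S ∣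
∣filter∣≤∣∣ P? f [] P⇒∈ = z≤n
∣filter∣≤∣∣ P? f (s ∷ S) P⇒∈ with P? (f zero) | ∣filter∣≤∣∣ P? (f ∘ suc) S (λ i → drop-there ∘ P⇒∈ (suc i))
∣filter∣≤∣∣ P? f (s ∷ S)      P⇒∈ | yes p | rec with P⇒∈ zero p
... | here = s≤s rec
∣filter∣≤∣∣ P? f (inside ∷ S) P⇒∈ | no _ | rec = ℕ.m≤n⇒m≤1+n rec
∣filter∣≤∣∣ P? f (outside ∷ S) P⇒∈ | no _ | rec = rec

-- Partitions and connected components.

module _ {n} (𝒫 : Partition n) where
  open Partition 𝒫

  partOf-∈ : ∀ v → v ∈ part (partOf v)
  partOf-∈ v = proj₁ (proj₂ (unique v))

  ∈⇒partOf≡ : ∀ {v i} → v ∈ part i → partOf v ≡ i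
  ∈⇒partOf≡ {v} v∈ = proj₂ (proj₂ (unique v)) v∈

-- Components are characterized without paths: `finest` says that equal labels are related by every
-- equivalence relation joining the ends of the edges in `F`. It is later applied to the relation
-- "the motion takes equal values at u and w", whence the level `ℓ`.
record Components {n m} (ends : Fin m → Fin n × Fin n) (F : Subset m) (ℓ : Level) : Set (lsuc ℓ) where
  field
    size    : ℕ
    label   : Fin n → Fin size
    rep     : Fin size → Fin n
    label∘rep : ∀ i → label (rep i) ≡ i
    joined  : ∀ {e} → e ∈ F → label (proj₁ (ends e)) ≡ label (proj₂ (ends e))
    finest  : ∀ {_∼_ : Rel (Fin n) ℓ} → IsEquivalence _∼_ →
              (∀ {e} → e ∈ F → proj₁ (ends e) ∼ proj₂ (ends e)) → ∀ u v → label u ≡ label v → u ∼ v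

  components-partition : Partition n
  components-partition = record
    { size     = size
    ; part     = λ i → Vec.tabulate λ v → does (label v Fin.≟ i)
    ; nonempty = λ i → rep i , ∈-part (label∘rep i)
    ; unique   = λ v → label v , ∈-part ≡.refl , λ v∈ → ∈-part⁻ v∈
    }
    where
    ∈-part : ∀ {v i} → label v ≡ i → v ∈ Vec.tabulate λ v → does (label v Fin.≟ i)
    ∈-part {v} {i} eq = Vec.lookup⇒[]= v _ (≡.trans (Vec.lookup∘tabulate _ v) (dec-true (label v Fin.≟ i) eq))
    ∈-part⁻ : ∀ {v i} → v ∈ (Vec.tabulate λ v → does (label v Fin.≟ i)) → label v ≡ i
    ∈-part⁻ {v} {i} v∈ with label v Fin.≟ i in eq
    ... | yes p = p
    ... | no ¬p = contradiction
      (≡.trans (≡.sym (≡.trans (Vec.lookup∘tabulate _ v) (dec-false (label v Fin.≟ i) ¬p))) (Vec.[]=⇒lookup v∈)) λ ()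

-- Adds one edge at a time. An edge between different labels `a` and `b` renames `b` to `a`;
-- `punchOut` at `b` then closes the gap in the labels, and the representative of `b` is dropped.
components : ∀ {n m} (ends : Fin m → Fin n × Fin n) F ℓ → Components ends F ℓ
components {n} ends [] ℓ = record
  { size = n ; label = id ; rep = id ; label∘rep = λ _ → ≡.refl ; joined = λ ()
  ; finest = λ isEq _ u v → λ { ≡.refl → IsEquivalence.refl isEq } }
components ends (outside ∷ F) ℓ = record
  { Components L ; joined = λ { (there e∈F) → joined e∈F } ; finest = λ isEq F∼ → finest isEq (F∼ ∘ there) }
  where
  L = components (ends ∘ suc) F ℓ
  open Components L
components ends (inside ∷ F) ℓ with components (ends ∘ suc) F ℓ
... | L = merge L
  where
  u₀ = proj₁ (ends zero)
  v₀ = proj₂ (ends zero)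
  merge : Components (ends ∘ suc) F ℓ → Components ends (inside ∷ F) ℓ
  merge L with Components.label L u₀ Fin.≟ Components.label L v₀
  ... | yes a≡b = record
    { Components L
    ; joined = λ { here → a≡b ; (there e∈F) → Components.joined L e∈F }
    ; finest = λ isEq F∼ → Components.finest L isEq (F∼ ∘ there) }
  merge record { size = zero ; label = label } | _ with () ← label u₀
  merge record { size = suc k ; label = label ; rep = rep ; label∘rep = label∘rep ; joined = joined ; finest = finest }
    | no a≢b = record
    { size    = k
    ; label   = label′
    ; rep     = rep ∘ punchIn b
    ; label∘rep = λ i → ≡.trans
        (Fin.punchOut-cong b {i≢k = Fin.punchInᵢ≢i b i ∘ ≡.sym}
           (≡.trans (≡.cong absorb (label∘rep (punchIn b i))) (absorb-≢ (Fin.punchInᵢ≢i b i))))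
        (Fin.punchOut-punchIn b)
    ; joined  = λ where
        here        → Fin.punchOut-cong b (≡.trans (absorb-≢ a≢b) (≡.sym absorb-b))
        (there e∈F) → Fin.punchOut-cong b (≡.cong absorb (joined e∈F))
    ; finest  = λ {_∼_} isEq F∼ x y eq → let
          open IsEquivalence isEq
          -- A vertex formerly labelled `b` is related to `v₀`, through the new edge to `u₀`, and
          -- from there to the representative of `a`.
          ∼rep : ∀ x → x ∼ rep (absorb (label x))
          ∼rep x = case label x Fin.≟ b of λ where
            (yes lx≡b) → trans (finest isEq (F∼ ∘ there) x v₀ lx≡b) (trans (sym (F∼ here))
              (finest isEq (F∼ ∘ there) u₀ _ (≡.sym (≡.trans (label∘rep _) (≡.trans (≡.cong absorb lx≡b) absorb-b)))))
            (no  lx≢b) → finest isEq (F∼ ∘ there) x _ (≡.sym (≡.trans (label∘rep _) (absorb-≢ lx≢b)))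
        in trans (∼rep x) (trans
             (reflexive (≡.cong rep (Fin.punchOut-injective (absorb≢b (label x)) (absorb≢b (label y)) eq)))
             (sym (∼rep y)))
    }
    where
    a = label u₀
    b = label v₀
    absorb : Fin (suc k) → Fin (suc k)
    absorb x with x Fin.≟ b
    ... | yes _ = a
    ... | no  _ = x
    absorb-b : absorb b ≡ a
    absorb-b with b Fin.≟ b
    ... | yes _   = ≡.refl
    ... | no  b≢b = contradiction ≡.refl b≢b
    absorb-≢ : ∀ {x} → x ≢ b → absorb x ≡ x
    absorb-≢ {x} x≢b with x Fin.≟ b
    ... | yes x≡b = contradiction x≡b x≢b
    ... | no  _   = ≡.refl
    absorb≢b : ∀ x → b ≢ absorb x
    absorb≢b x b≡ with x Fin.≟ b
    ... | yes _   = a≢b (≡.sym b≡)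
    ... | no  x≢b = x≢b (≡.sym b≡)
    label′ : _ → Fin k
    label′ v = punchOut (absorb≢b (label v))

-- Arithmetic of uncrossing two edge sets.

∣∁∣-modular : ∀ {m} (F F′ : Subset m) → ∣ ∁ F ∣ ℕ.+ ∣ ∁ F′ ∣ ≡ ∣ ∁ (F ∪ F′) ∣ ℕ.+ ∣ ∁ (F ∩ F′) ∣
∣∁∣-modular []            []             = ≡.refl
∣∁∣-modular (inside  ∷ F) (inside  ∷ F′) = ∣∁∣-modular F F′
∣∁∣-modular (inside  ∷ F) (outside ∷ F′) =
  ≡.trans (ℕ.+-suc _ _) (≡.trans (≡.cong suc (∣∁∣-modular F F′)) (≡.sym (ℕ.+-suc _ _)))
∣∁∣-modular (outside ∷ F) (inside  ∷ F′) =
  ≡.trans (≡.cong suc (∣∁∣-modular F F′)) (≡.sym (ℕ.+-suc _ _))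
∣∁∣-modular (outside ∷ F) (outside ∷ F′) =
  ≡.cong suc (≡.trans (ℕ.+-suc _ _) (≡.trans (≡.cong suc (∣∁∣-modular F F′)) (≡.sym (ℕ.+-suc _ _))))

-- The counts `a`, `b`, `u`, `i` belong to F, F′, their union and their intersection; `x`, `y`, `q`,
-- `p` are the respective dimensions. F and F′ contribute an excess of at least two, the
-- intersection absorbs at most one, so the union keeps an excess.
uncross-≤ : ∀ {a b u i x y p q} → a ℕ.+ b ≡ u ℕ.+ i → a ℕ.< x → b ℕ.< y → x ℕ.+ y ℕ.≤ p ℕ.+ q → p ℕ.≤ suc i → u ℕ.< q
uncross-≤ {a} {b} {u} {i} {x} {y} {p} {q} a+b≡u+i a<x b<y x+y≤p+q p≤1+i = ℕ.+-cancelˡ-≤ (suc i) _ _ (begin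
  suc i ℕ.+ suc u          ≡⟨ ≡.cong suc (ℕ.+-suc i u) ⟩
  2 ℕ.+ (i ℕ.+ u)          ≡⟨ ≡.cong (2 ℕ.+_) (≡.trans (ℕ.+-comm i u) (≡.sym a+b≡u+i)) ⟩
  2 ℕ.+ (a ℕ.+ b)          ≡⟨ ≡.cong suc (ℕ.+-suc a b) ⟨
  suc a ℕ.+ suc b          ≤⟨ ℕ.+-mono-≤ a<x b<y ⟩
  x ℕ.+ y                  ≤⟨ x+y≤p+q ⟩
  p ℕ.+ q                  ≤⟨ ℕ.+-monoˡ-≤ q p≤1+i ⟩
  suc i ℕ.+ q              ∎)
  where open ℕ.≤-Reasoning

-- A ring solver with integer coefficients.

-- In an abstract ring equality with 0 does not compute, so the solver needs integer coefficients to cancel terms.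
module ℤ-Solver {c ℓ} (K : CommutativeRing c ℓ) where
  open CommutativeRing K
  open RingProperties ring using (-0#≈0#; -‿involutive; -‿+-comm; -‿distribˡ-*)
  open Mult +-monoid using (×-homo-+) renaming (_×_ to _⋆_)
  open SetoidReasoning setoid

  fromℤ : ℤ → Carrier
  fromℤ (+ n)      = n ⋆ 1#
  fromℤ (-[1+ n ]) = - (suc n ⋆ 1#)

  fromℤ-⊖ : ∀ m n → fromℤ (m ℤ.⊖ n) ≈ m ⋆ 1# - n ⋆ 1#
  fromℤ-⊖ m       zero    = sym (trans (+-congˡ -0#≈0#) (+-identityʳ _))
  fromℤ-⊖ zero    (suc n) = sym (+-identityˡ _)
  fromℤ-⊖ (suc m) (suc n) = begin
    fromℤ (suc m ℤ.⊖ suc n)             ≡⟨ ≡.cong fromℤ (ℤ.[1+m]⊖[1+n]≡m⊖n m n) ⟩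
    fromℤ (m ℤ.⊖ n)                     ≈⟨ fromℤ-⊖ m n ⟩
    x - y                               ≈⟨ +-congʳ (+-identityˡ x) ⟨
    (0# + x) - y                        ≈⟨ +-congʳ (+-congʳ (-‿inverseʳ 1#)) ⟨
    ((1# - 1#) + x) - y                 ≈⟨ +-congʳ (+-assoc _ _ _) ⟩
    (1# + (- 1# + x)) - y               ≈⟨ +-congʳ (+-congˡ (+-comm _ _)) ⟩
    (1# + (x - 1#)) - y                 ≈⟨ +-congʳ (+-assoc _ _ _) ⟨
    ((1# + x) - 1#) - y                 ≈⟨ +-assoc _ _ _ ⟩
    (1# + x) + (- 1# - y)               ≈⟨ +-congˡ (-‿+-comm 1# y) ⟩
    (1# + x) - (1# + y)                 ∎
    where
    x = m ⋆ 1#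
    y = n ⋆ 1#

  fromℤ-neg : ∀ i → fromℤ (ℤ.- i) ≈ - fromℤ i
  fromℤ-neg +0           = sym -0#≈0#
  fromℤ-neg (+ suc n)    = refl
  fromℤ-neg (-[1+ n ])   = sym (-‿involutive _)

  fromℤ-+ : ∀ i j → fromℤ (i ℤ.+ j) ≈ fromℤ i + fromℤ j
  fromℤ-+ (+ m)      (+ n)      = ×-homo-+ 1# m n
  fromℤ-+ (+ m)      (-[1+ n ]) = fromℤ-⊖ m (suc n)
  fromℤ-+ (-[1+ m ]) (+ n)      = trans (fromℤ-⊖ n (suc m)) (+-comm _ _)
  fromℤ-+ (-[1+ m ]) (-[1+ n ]) = begin
    - (suc (suc (m ℕ.+ n)) ⋆ 1#)        ≈⟨ -‿cong (+-congˡ (×-homo-+ 1# (suc m) n)) ⟩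
    - (1# + (suc m ⋆ 1# + n ⋆ 1#))      ≈⟨ -‿cong (+-assoc _ _ _) ⟨
    - ((1# + suc m ⋆ 1#) + n ⋆ 1#)      ≈⟨ -‿cong (+-congʳ (+-comm _ _)) ⟩
    - ((suc m ⋆ 1# + 1#) + n ⋆ 1#)      ≈⟨ -‿cong (+-assoc _ _ _) ⟩
    - (suc m ⋆ 1# + suc n ⋆ 1#)         ≈⟨ -‿+-comm _ _ ⟨
    - (suc m ⋆ 1#) - (suc n ⋆ 1#)       ∎

  fromℤ-pos-* : ∀ m j → fromℤ (+ m ℤ.* j) ≈ m ⋆ 1# * fromℤ j
  fromℤ-pos-* zero    j = sym (zeroˡ _)
  fromℤ-pos-* (suc m) j = begin
    fromℤ (+ suc m ℤ.* j)               ≡⟨ ≡.cong fromℤ (ℤ.suc-* (+ m) j) ⟩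
    fromℤ (j ℤ.+ + m ℤ.* j)             ≈⟨ fromℤ-+ j (+ m ℤ.* j) ⟩
    fromℤ j + fromℤ (+ m ℤ.* j)         ≈⟨ +-cong (sym (*-identityˡ _)) (fromℤ-pos-* m j) ⟩
    1# * fromℤ j + m ⋆ 1# * fromℤ j     ≈⟨ distribʳ _ _ _ ⟨
    (1# + m ⋆ 1#) * fromℤ j             ∎

  fromℤ-* : ∀ i j → fromℤ (i ℤ.* j) ≈ fromℤ i * fromℤ j
  fromℤ-* (+ m)      j = fromℤ-pos-* m j
  fromℤ-* (-[1+ m ]) j = begin
    fromℤ (-[1+ m ] ℤ.* j)              ≡⟨ ≡.cong fromℤ (ℤ.neg-distribˡ-* (+ suc m) j) ⟨
    fromℤ (ℤ.- (+ suc m ℤ.* j))         ≈⟨ fromℤ-neg (+ suc m ℤ.* j) ⟩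
    - fromℤ (+ suc m ℤ.* j)             ≈⟨ -‿cong (fromℤ-pos-* (suc m) j) ⟩
    - (suc m ⋆ 1# * fromℤ j)            ≈⟨ -‿distribˡ-* _ _ ⟩
    - (suc m ⋆ 1#) * fromℤ j            ∎

  fromℤ-morphism : ℤ.+-*-rawRing -Raw-AlmostCommutative⟶ fromCommutativeRing K
  fromℤ-morphism = record
    { ⟦_⟧    = fromℤ
    ; +-homo = fromℤ-+
    ; *-homo = fromℤ-*
    ; -‿homo = fromℤ-neg
    ; 0-homo = refl
    ; 1-homo = +-identityʳ 1#
    }

  open RingSolver ℤ.+-*-rawRing (fromCommutativeRing K) fromℤ-morphism
    (λ i j → Maybe.map (λ p → reflexive (≡.cong fromℤ p)) (dec⇒maybe (i ℤ.≟ j))) public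
    using (solve; _:=_; _:+_; _:*_; _:-_; :-_)

-- Linear algebra over a field with decidable equality.

module LinearAlgebra {c ℓ} (K : CommutativeRing c ℓ)
  (_≟_ : Decidable (CommutativeRing._≈_ K))
  (1≉0 : ¬ CommutativeRing._≈_ K (CommutativeRing.1# K) (CommutativeRing.0# K))
  (inverse : ∀ x → ¬ CommutativeRing._≈_ K x (CommutativeRing.0# K) →
             ∃ λ y → CommutativeRing._≈_ K (CommutativeRing._*_ K x y) (CommutativeRing.1# K))
  where

  open CommutativeRing K hiding (zero)
  open RingProperties ring using (-1*x≈-x)
  open GroupProperties +-group using () renaming (x∙y⁻¹≈ε⇒x≈y to x-y≈0⇒x≈y) public
  open SemiringSum semiring
    using (sum; sum-cong-≋; sum-replicate-zero; sum-remove; ∑-distrib-+; *-distribˡ-sum; *-distribʳ-sum)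
    public
  open ℤ-Solver K
  open SetoidReasoning setoid

  sum-zero : ∀ {n} {t : Fin n → Carrier} → (∀ i → t i ≈ 0#) → sum t ≈ 0#
  sum-zero {n} t≈0 = trans (sum-cong-≋ t≈0) (sum-replicate-zero n)

  sum-single : ∀ {n} {t : Fin n → Carrier} j → (∀ i → i ≢ j → t i ≈ 0#) → sum t ≈ t j
  sum-single {suc n} {t} j t≈0 = begin
    sum t                         ≈⟨ sum-remove {i = j} t ⟩
    t j + sum (t ∘ punchIn j)     ≈⟨ +-congˡ (sum-zero λ i → t≈0 _ (Fin.punchInᵢ≢i j i)) ⟩
    t j + 0#                      ≈⟨ +-identityʳ _ ⟩
    t j                           ∎

  δ : ∀ {n} → Fin n → Fin n → Carrier
  δ i j = if does (i Fin.≟ j) then 1# else 0#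

  δ-refl : ∀ {n} (i : Fin n) → δ i i ≈ 1#
  δ-refl i rewrite dec-true (i Fin.≟ i) ≡.refl = refl

  δ-≢ : ∀ {n} {i j : Fin n} → i ≢ j → δ i j ≈ 0#
  δ-≢ {i = i} {j} i≢j rewrite dec-false (i Fin.≟ j) i≢j = refl

  infix 4 _≋_
  _≋_ : {A : Set} → (A → Carrier) → (A → Carrier) → Set ℓ
  x ≋ y = ∀ a → x a ≈ y a

  𝟎 : {A : Set} → A → Carrier
  𝟎 _ = 0#

  combination : ∀ {A : Set} {n} → (Fin n → Carrier) → (Fin n → A → Carrier) → A → Carrier
  combination s b a = sum λ i → s i * b i a

  record LinearForm (A : Set) : Set (c ⊔ ℓ) where
    infixr 8 _·_
    field
      _·_    : (A → Carrier) → Carrier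
      ·-cong : ∀ {x y} → x ≋ y → _·_ x ≈ _·_ y
      linear : ∀ x s y → _·_ (λ a → x a + s * y a) ≈ _·_ x + s * _·_ y

    ·-zero : ∀ {x} → x ≋ 𝟎 → _·_ x ≈ 0#
    ·-zero {x} x≈0 = begin
      _·_ x                        ≈⟨ ·-cong (λ a → trans (x≈0 a) (sym (trans (+-cong (x≈0 a)
                                        (trans (*-congˡ (x≈0 a)) (zeroʳ _))) (+-identityʳ 0#)))) ⟩
      _·_ (λ a → x a + - 1# * x a) ≈⟨ linear x (- 1#) x ⟩
      _·_ x + - 1# * _·_ x         ≈⟨ +-congˡ (-1*x≈-x _) ⟩
      _·_ x - _·_ x                ≈⟨ -‿inverseʳ _ ⟩
      0#                           ∎

    ·-combination : ∀ {n} s (b : Fin n → A → Carrier) →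
                    _·_ (combination s b) ≈ sum λ i → s i * _·_ (b i)
    ·-combination {zero}  s b = ·-zero λ _ → refl
    ·-combination {suc n} s b = begin
      _·_ (combination s b)
        ≈⟨ ·-cong (λ a → +-comm _ _) ⟩
      _·_ (λ a → combination (s ∘ suc) (b ∘ suc) a + s zero * b zero a)
        ≈⟨ linear _ _ _ ⟩
      _·_ (combination (s ∘ suc) (b ∘ suc)) + s zero * _·_ (b zero)
        ≈⟨ +-comm _ _ ⟩
      s zero * _·_ (b zero) + _·_ (combination (s ∘ suc) (b ∘ suc))
        ≈⟨ +-congˡ (·-combination (s ∘ suc) (b ∘ suc)) ⟩
      sum (λ i → s i * _·_ (b i)) ∎

  open LinearForm public

  coordinate : ∀ {A : Set} → A → LinearForm A
  coordinate a = record { _·_ = λ x → x a ; ·-cong = λ x≋y → x≋y a ; linear = λ _ _ _ → refl }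

  record Subspace (A : Set) : Set (c ⊔ lsuc ℓ) where
    infix 4 _∋_
    field
      _∋_      : (A → Carrier) → Set ℓ
      ∋-resp   : ∀ {x y} → x ≋ y → _∋_ x → _∋_ y
      ∋-zero   : _∋_ 𝟎
      ∋-linear : ∀ {x y} → _∋_ x → ∀ s → _∋_ y → _∋_ (λ a → x a + s * y a)

    ∋-combination : ∀ {n} s {b : Fin n → A → Carrier} → (∀ i → _∋_ (b i)) → _∋_ (combination s b)
    ∋-combination {zero}  s b∈ = ∋-zero
    ∋-combination {suc n} s b∈ =
      ∋-resp (λ a → +-comm _ _) (∋-linear (∋-combination (s ∘ suc) (b∈ ∘ suc)) (s zero) (b∈ zero))

  open Subspace public

  infix 4 _⊆ˢ_
  _⊆ˢ_ : ∀ {A} → Subspace A → Subspace A → Set (c ⊔ ℓ)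
  P ⊆ˢ Q = ∀ x → P ∋ x → Q ∋ x

  full : ∀ {A} → Subspace A
  full = record
    { _∋_ = λ _ → Level.Lift _ ⊤ ; ∋-resp = λ _ _ → _ ; ∋-zero = _ ; ∋-linear = λ _ _ _ → _ }

  infixl 6 _⊓_
  _⊓_ : ∀ {A T : Set} → Subspace A → (T → LinearForm A) → Subspace A
  P ⊓ ψ = record
    { _∋_      = λ x → P ∋ x × (∀ t → ψ t · x ≈ 0#)
    ; ∋-resp   = λ x≋y (x∈P , ψx≈0) →
        ∋-resp P x≋y x∈P , λ t → trans (·-cong (ψ t) (λ a → sym (x≋y a))) (ψx≈0 t)
    ; ∋-zero   = ∋-zero P , λ t → ·-zero (ψ t) (λ _ → refl)
    ; ∋-linear = λ (x∈P , ψx≈0) s (y∈P , ψy≈0) →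
        ∋-linear P x∈P s y∈P , λ t → trans (linear (ψ t) _ s _)
          (trans (+-cong (ψx≈0 t) (trans (*-congˡ (ψy≈0 t)) (zeroʳ s))) (+-identityʳ 0#))
    }

  infixl 6 _⊓₁_
  _⊓₁_ : ∀ {A} → Subspace A → LinearForm A → Subspace A
  P ⊓₁ φ = P ⊓ λ (_ : ⊤) → φ

  -- Duality encodes independence and `expand` encodes spanning. The coordinates are forms on the
  -- whole ambient space, so those of one subspace can serve as equations on another, as in
  -- `Basis-mono` and `modular`.
  record Basis {A : Set} (P : Subspace A) (t : ℕ) : Set (c ⊔ ℓ) where
    field
      vec    : Fin t → A → Carrier
      coord  : Fin t → LinearForm A
      vec∈   : ∀ i → P ∋ vec i
      dual-≡ : ∀ i → coord i · vec i ≈ 1#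
      dual-≢ : ∀ {i j} → i ≢ j → coord i · vec j ≈ 0#
      expand : ∀ x → P ∋ x → x ≋ combination (λ i → coord i · x) vec

  open Basis public

  Basis-resp : ∀ {A t} {P Q : Subspace A} → P ⊆ˢ Q → Q ⊆ˢ P → Basis P t → Basis Q t
  Basis-resp P⊆Q Q⊆P B = record
    { vec = vec B ; coord = coord B ; vec∈ = λ i → P⊆Q _ (vec∈ B i)
    ; dual-≡ = dual-≡ B ; dual-≢ = dual-≢ B ; expand = λ x x∈Q → expand B x (Q⊆P x x∈Q) }

  full-Basis : ∀ {A N} → A ↔ Fin N → Basis (full {A}) N
  full-Basis {A} {N} A↔N = record
    { vec    = λ i a → δ i (to a)
    ; coord  = λ i → coordinate (from i)
    ; vec∈   = λ _ → _
    ; dual-≡ = λ i → trans (reflexive (≡.cong (δ i) (strictlyInverseˡ i))) (δ-refl i)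
    ; dual-≢ = λ {i} {j} i≢j →
        trans (reflexive (≡.cong (δ j) (strictlyInverseˡ i))) (δ-≢ (i≢j ∘ ≡.sym))
    ; expand = λ x _ a → sym (begin
        sum (λ i → x (from i) * δ i (to a))
          ≈⟨ sum-single (to a) (λ i i≢a → trans (*-congˡ (δ-≢ i≢a)) (zeroʳ _)) ⟩
        x (from (to a)) * δ (to a) (to a)
          ≈⟨ *-cong (reflexive (≡.cong x (strictlyInverseʳ a))) (δ-refl (to a)) ⟩
        x a * 1#
          ≈⟨ *-identityʳ _ ⟩
        x a ∎)
    }
    where open Inverse A↔N

  -- One step of Gaussian elimination with pivot b_i, where φ b_i is invertible: the vectors b_j -
  -- (φ b_j / φ b_i) b_i lie in the kernel of φ. The remaining coordinates are kept, since they
  -- vanish at b_i.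
  vanishes-or-cuts : ∀ {A t} {P : Subspace A} → Basis P t → (φ : LinearForm A) →
                     (∀ x → P ∋ x → φ · x ≈ 0#) ⊎ (∃ λ t′ → t ≡ suc t′ × Basis (P ⊓₁ φ) t′)
  vanishes-or-cuts {t = t} {P} B φ with Fin.any? (λ i → ¬? ((φ · vec B i) ≟ 0#))
  ... | no  all-vanish = inj₁ λ x x∈P → begin
    φ · x                                     ≈⟨ ·-cong φ (expand B x x∈P) ⟩
    φ · combination (λ i → coord B i · x) (vec B)
                                              ≈⟨ ·-combination φ _ (vec B) ⟩
    sum (λ i → coord B i · x * φ · vec B i)   ≈⟨ sum-zero (λ i → trans (*-congˡ (φb≈0 i)) (zeroʳ _)) ⟩
    0#                                        ∎
    where
    φb≈0 : ∀ i → φ · vec B i ≈ 0#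
    φb≈0 i = decidable-stable ((φ · vec B i) ≟ 0#) λ φb≉0 → all-vanish (i , φb≉0)
  vanishes-or-cuts {t = suc t} {P} B φ | yes (i , φb≉0) = inj₂ (t , ≡.refl , record
    { vec    = b′
    ; coord  = coord B ∘ punchIn i
    ; vec∈   = λ j → ∋-linear P (vec∈ B _) _ (vec∈ B i) , λ _ → (begin
        φ · b′ j                                ≈⟨ linear φ _ _ _ ⟩
        p j + - (p j * u) * φ · b               ≈⟨ solve 3 (λ x u y → x :+ :- (x :* u) :* y := x :+ :- (x :* (y :* u))) refl (p j) u (φ · b) ⟩
        p j - p j * (φ · b * u)                 ≈⟨ +-congˡ (-‿cong (trans (*-congˡ φb*u≈1) (*-identityʳ _))) ⟩
        p j - p j                               ≈⟨ -‿inverseʳ _ ⟩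
        0#                                      ∎)
    ; dual-≡ = λ j → trans (coord-b′ j j) (dual-≡ B _)
    ; dual-≢ = λ {j} {k} j≢k → trans (coord-b′ j k) (dual-≢ B (j≢k ∘ Fin.punchIn-injective i j k))
    ; expand = λ x (x∈P , φx≈0) a → let c = λ j → coord B (punchIn i j) · x ; cᵢ = coord B i · x in begin
        x a
          ≈⟨ expand B x x∈P a ⟩
        combination (λ j → coord B j · x) (vec B) a
          ≈⟨ sum-remove {i = i} (λ j → coord B j · x * vec B j a) ⟩
        cᵢ * b a + S x a
          -- On the kernel of φ, `relation` expresses the pivot coordinate `cᵢ` through the other
          -- coordinates, which removes `b` from the expansion.
          ≈⟨ +-congʳ (begin
             cᵢ * b a                                   ≈⟨ *-identityʳ _ ⟨
             cᵢ * b a * 1#                              ≈⟨ *-congˡ φb*u≈1 ⟨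
             cᵢ * b a * (φ · b * u)                     ≈⟨ solve 5 (λ c b y u T →
               c :* b :* (y :* u) := u :* b :* (c :* y :+ T) :+ T :* :- (u :* b)) refl cᵢ (b a) (φ · b) u (T x) ⟩
             u * b a * (cᵢ * φ · b + T x) + T x * - (u * b a)
                                                        ≈⟨ +-congʳ (trans (*-congˡ (relation x x∈P (φx≈0 tt))) (zeroʳ _)) ⟩
             0# + T x * - (u * b a)                     ≈⟨ +-identityˡ _ ⟩
             T x * - (u * b a)                          ∎) ⟩
        T x * - (u * b a) + S x a
          ≈⟨ +-congʳ (*-distribʳ-sum _ (λ j → c j * p j)) ⟩
        sum (λ j → c j * p j * - (u * b a)) + S x a
          ≈⟨ ∑-distrib-+ (λ j → c j * p j * - (u * b a)) (λ j → c j * vec B (punchIn i j) a) ⟨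
        sum (λ j → c j * p j * - (u * b a) + c j * vec B (punchIn i j) a)
          ≈⟨ sum-cong-≋ (λ j → solve 5 (λ c p u b v → c :* p :* :- (u :* b) :+ c :* v := c :* (v :+ :- (p :* u) :* b))
               refl (c j) (p j) u (b a) (vec B (punchIn i j) a)) ⟩
        combination c b′ a ∎
    })
    where
    b = vec B i
    u = proj₁ (inverse (φ · b) φb≉0)
    φb*u≈1 : φ · b * u ≈ 1#
    φb*u≈1 = proj₂ (inverse (φ · b) φb≉0)
    p : Fin t → Carrier
    p j = φ · vec B (punchIn i j)
    b′ : Fin t → _ → Carrier
    b′ j a = vec B (punchIn i j) a + - (p j * u) * b a
    S : ∀ x a → Carrier
    S x a = combination (λ j → coord B (punchIn i j) · x) (vec B ∘ punchIn i) a
    T : ∀ x → Carrier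
    T x = sum (λ j → coord B (punchIn i j) · x * p j)
    coord-b′ : ∀ j k → coord B (punchIn i j) · b′ k ≈ coord B (punchIn i j) · vec B (punchIn i k)
    coord-b′ j k = begin
      coord B (punchIn i j) · b′ k                ≈⟨ linear (coord B (punchIn i j)) _ _ _ ⟩
      coord B (punchIn i j) · vec B (punchIn i k) + - (p k * u) * coord B (punchIn i j) · b
                                                  ≈⟨ +-congˡ (trans (*-congˡ (dual-≢ B (Fin.punchInᵢ≢i i j))) (zeroʳ _)) ⟩
      coord B (punchIn i j) · vec B (punchIn i k) + 0#
                                                  ≈⟨ +-identityʳ _ ⟩
      coord B (punchIn i j) · vec B (punchIn i k) ∎
    relation : ∀ x → P ∋ x → φ · x ≈ 0# → coord B i · x * φ · b + T x ≈ 0#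
    relation x x∈P φx≈0 = begin
      coord B i · x * φ · b + T x                       ≈⟨ sum-remove {i = i} (λ j → coord B j · x * φ · vec B j) ⟨
      sum (λ j → coord B j · x * φ · vec B j)           ≈⟨ ·-combination φ (λ j → coord B j · x) (vec B) ⟨
      φ · combination (λ j → coord B j · x) (vec B)     ≈⟨ ·-cong φ (expand B x x∈P) ⟨
      φ · x                                             ≈⟨ φx≈0 ⟩
      0#                                                ∎

  cut₁ : ∀ {A t} {P : Subspace A} → Basis P t → (φ : LinearForm A) →
         ∃ λ t′ → Basis (P ⊓₁ φ) t′ × t ℕ.≤ suc t′
  cut₁ {t = t} B φ with vanishes-or-cuts B φ
  ... | inj₁ φ≈0                = t , Basis-resp (λ x x∈P → x∈P , λ _ → φ≈0 x x∈P) (λ _ → proj₁) B , ℕ.n≤1+n t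
  ... | inj₂ (t′ , ≡.refl , B′) = t′ , B′ , ℕ.≤-refl

  cut : ∀ {A t s} {P : Subspace A} → Basis P t → (ψ : Fin s → LinearForm A) →
        ∃ λ t′ → Basis (P ⊓ ψ) t′ × t ℕ.≤ s ℕ.+ t′
  cut {t = t} {zero}  B ψ = t , Basis-resp (λ x x∈P → x∈P , λ ()) (λ _ → proj₁) B , ℕ.≤-refl
  cut {t = t} {suc s} B ψ with cut₁ B (ψ zero)
  ... | t₁ , B₁ , t≤1+t₁ with cut B₁ (ψ ∘ suc)
  ... | t₂ , B₂ , t₁≤s+t₂ =
    t₂
    , Basis-resp (λ x ((x∈P , ψ₀x≈0) , ψx≈0) → x∈P , λ { zero → ψ₀x≈0 tt ; (suc i) → ψx≈0 i })
                 (λ x (x∈P , ψx≈0) → (x∈P , λ _ → ψx≈0 zero) , ψx≈0 ∘ suc) B₂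
    , ℕ.≤-trans t≤1+t₁ (s≤s t₁≤s+t₂)

  cut-finite : ∀ {A T t s} {P : Subspace A} → T ↔ Fin s → Basis P t → (ψ : T → LinearForm A) → ∃ λ t′ → Basis (P ⊓ ψ) t′
  cut-finite T↔s B ψ with cut B (ψ ∘ Inverse.from T↔s)
  ... | t′ , B′ , _ = t′ , Basis-resp
    (λ x (x∈P , ψx≈0) → x∈P , λ t → ≡.subst (λ t → ψ t · x ≈ 0#) (Inverse.strictlyInverseʳ T↔s t) (ψx≈0 (Inverse.to T↔s t)))
    (λ x (x∈P , ψx≈0) → x∈P , ψx≈0 ∘ Inverse.from T↔s) B′

  -- Each equation lowers the dimension by at most one, so with t > s a basis vector of the solution
  -- space would survive; its own dual coordinate equals 1, so it is not zero. This is the source of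
  -- `Basis-mono`, `modular` and the dimension bounds in both directions of the theorem.
  unknowns≤equations : ∀ {A t s} {P : Subspace A} → Basis P t → (ψ : Fin s → LinearForm A) →
                       (∀ x → P ∋ x → (∀ i → ψ i · x ≈ 0#) → x ≋ 𝟎) → t ℕ.≤ s
  unknowns≤equations B ψ trivial with cut B ψ
  ... | zero   , _  , t≤s = ℕ.≤-trans t≤s (ℕ.≤-reflexive (ℕ.+-identityʳ _))
  ... | suc t′ , B′ , _   = contradiction
    (trans (sym (dual-≡ B′ zero))
      (·-zero (coord B′ zero) (trivial _ (proj₁ (vec∈ B′ zero)) (proj₂ (vec∈ B′ zero))))) 1≉0

  coords-zero : ∀ {A t} {P : Subspace A} (B : Basis P t) x → P ∋ x → (∀ i → coord B i · x ≈ 0#) → x ≋ 𝟎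
  coords-zero B x x∈P c≈0 a =
    trans (expand B x x∈P a) (sum-zero {t = λ i → coord B i · x * vec B i a} λ i → trans (*-congʳ (c≈0 i)) (zeroˡ _))

  Basis-mono : ∀ {A t s} {P Q : Subspace A} → P ⊆ˢ Q → Basis P t → Basis Q s → t ℕ.≤ s
  Basis-mono P⊆Q B C = unknowns≤equations B (coord C) λ x x∈P → coords-zero C x (P⊆Q x x∈P)

  combination-zero : ∀ {A t} {P : Subspace A} (B : Basis P t) s → combination s (vec B) ≋ 𝟎 → ∀ i → s i ≈ 0#
  combination-zero B s sb≈0 i = begin
    s i                                         ≈⟨ *-identityʳ _ ⟨
    s i * 1#                                    ≈⟨ *-congˡ (dual-≡ B i) ⟨
    s i * coord B i · vec B i                   ≈⟨ sum-single i (λ j j≢i → trans (*-congˡ (dual-≢ B (j≢i ∘ ≡.sym))) (zeroʳ _)) ⟨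
    sum (λ j → s j * coord B i · vec B j)       ≈⟨ ·-combination (coord B i) s (vec B) ⟨
    coord B i · combination s (vec B)           ≈⟨ ·-zero (coord B i) sb≈0 ⟩
    0#                                          ∎

  combination-cong : ∀ {A : Set} {n} {r s : Fin n → Carrier} (b : Fin n → A → Carrier) → r ≋ s → combination r b ≋ combination s b
  combination-cong b r≋s a = sum-cong-≋ λ i → *-congʳ (r≋s i)

  combination-linear : ∀ {A : Set} {n} (r : Fin n → Carrier) u s (b : Fin n → A → Carrier) a →
    combination (λ i → r i + u * s i) b a ≈ combination r b a + u * combination s b a
  combination-linear r u s b a = begin
    sum (λ i → (r i + u * s i) * b i a)
      ≈⟨ sum-cong-≋ (λ i → solve 4 (λ r u s b → (r :+ u :* s) :* b := r :* b :+ u :* (s :* b)) refl (r i) u (s i) (b i a)) ⟩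
    sum (λ i → r i * b i a + u * (s i * b i a))
      ≈⟨ ∑-distrib-+ (λ i → r i * b i a) _ ⟩
    combination r b a + sum (λ i → u * (s i * b i a))
      ≈⟨ +-congˡ (*-distribˡ-sum u (λ i → s i * b i a)) ⟨
    combination r b a + u * combination s b a ∎

  pullback : ∀ {A B : Set} → LinearForm B → (T : (A → Carrier) → B → Carrier) →
             (∀ {x y} → x ≋ y → T x ≋ T y) →
             (∀ x s y → T (λ a → x a + s * y a) ≋ (λ b → T x b + s * T y b)) → LinearForm A
  pullback φ T T-cong T-linear = record
    { _·_    = λ x → φ · T x
    ; ·-cong = λ x≋y → ·-cong φ (T-cong x≋y)
    ; linear = λ x s y → trans (·-cong φ (T-linear x s y)) (linear φ _ s _)
    }

  combining : ∀ {A B : Set} {n} → (Fin n → B) → (Fin n → A → Carrier) → LinearForm A → LinearForm B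
  combining i b φ = pullback φ (λ x → combination (x ∘ i) b)
    (λ x≋y a → sum-cong-≋ λ j → *-congʳ (x≋y (i j)))
    (λ x s y a → combination-linear (x ∘ i) s (y ∘ i) b a)

  -- Unknowns: the coordinates of a pair (x , y) ∈ P × Q.  Equations: x − y has zero coordinates in R, and then
  -- x ∈ P ∩ Q has zero coordinates in S.
  modular : ∀ {A p q r s} {P Q R S : Subspace A} → P ⊆ˢ R → Q ⊆ˢ R → (∀ x → P ∋ x → Q ∋ x → S ∋ x) →
            Basis P p → Basis Q q → Basis R r → Basis S s → p ℕ.+ q ℕ.≤ r ℕ.+ s
  modular {A} {p} {q} {r} {s} {P} {Q} {R} {S} P⊆R Q⊆R P∩Q⊆S BP BQ BR BS =
    unknowns≤equations (full-Basis (↔-sym Fin.+↔⊎)) (ψ ∘ Inverse.to (Fin.+↔⊎ {r} {s})) trivial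
    where
    left  : (Fin p ⊎ Fin q → Carrier) → A → Carrier
    left z = combination (z ∘ inj₁) (vec BP)
    right : (Fin p ⊎ Fin q → Carrier) → A → Carrier
    right z = combination (z ∘ inj₂) (vec BQ)
    difference : LinearForm A → LinearForm (Fin p ⊎ Fin q)
    difference φ = pullback φ (λ z a → left z a - right z a)
      (λ x≋y a → +-cong (sum-cong-≋ λ j → *-congʳ (x≋y (inj₁ j))) (-‿cong (sum-cong-≋ λ j → *-congʳ (x≋y (inj₂ j)))))
      (λ x u y a → begin
        left (λ a → x a + u * y a) a - right (λ a → x a + u * y a) a
          ≈⟨ +-cong (combination-linear (x ∘ inj₁) u (y ∘ inj₁) (vec BP) a)
                    (-‿cong (combination-linear (x ∘ inj₂) u (y ∘ inj₂) (vec BQ) a)) ⟩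
        (left x a + u * left y a) - (right x a + u * right y a)
          ≈⟨ solve 5 (λ l m u r s → (l :+ u :* m) :- (r :+ u :* s) := (l :- r) :+ u :* (m :- s)) refl
               (left x a) (left y a) u (right x a) (right y a) ⟩
        (left x a - right x a) + u * (left y a - right y a) ∎)
    ψ : Fin r ⊎ Fin s → LinearForm (Fin p ⊎ Fin q)
    ψ = [ difference ∘ coord BR , combining inj₁ (vec BP) ∘ coord BS ]′
    trivial : ∀ z → full ∋ z → (∀ i → ψ (Inverse.to (Fin.+↔⊎ {r} {s}) i) · z ≈ 0#) → z ≋ 𝟎
    trivial z _ ψz≈0 = [ left-zero , right-zero ]
      where
      ψ≈0 : ∀ i → ψ i · z ≈ 0#
      ψ≈0 i = ≡.subst (λ i → ψ i · z ≈ 0#) (Inverse.strictlyInverseˡ (Fin.+↔⊎ {r} {s}) i) (ψz≈0 (Inverse.from (Fin.+↔⊎ {r} {s}) i))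
      left∈ : P ∋ left z
      left∈ = ∋-combination P _ (vec∈ BP)
      right∈ : Q ∋ right z
      right∈ = ∋-combination Q _ (vec∈ BQ)
      left≋right : left z ≋ right z
      left≋right a = x-y≈0⇒x≈y _ _ (coords-zero BR (λ a → left z a - right z a)
        (∋-resp R (λ a → +-congˡ (-1*x≈-x _)) (∋-linear R (P⊆R _ left∈) (- 1#) (Q⊆R _ right∈)))
        (ψ≈0 ∘ inj₁) a)
      left≋0 : left z ≋ 𝟎
      left≋0 = coords-zero BS (left z) (P∩Q⊆S _ left∈ (∋-resp Q (λ a → sym (left≋right a)) right∈)) (ψ≈0 ∘ inj₂)
      left-zero : ∀ i → z (inj₁ i) ≈ 0#
      left-zero = combination-zero BP (z ∘ inj₁) left≋0
      right-zero : ∀ i → z (inj₂ i) ≈ 0#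
      right-zero = combination-zero BQ (z ∘ inj₂) λ a → trans (sym (left≋right a)) (left≋0 a)

  -- Rado's theorem on transversals of families of linear forms.

  module Rado {A : Set} {k : ℕ} where

    constraints : ∀ {m} → (Fin m → Fin k → LinearForm A) → (F : Subset m) →
                  ∃ (_∈ F) × Fin k → LinearForm A
    constraints φ F ((e , _) , i) = φ e i

    constraints-∷⊆ : ∀ {m} P (φ : Fin (suc m) → Fin k → LinearForm A) F →
      P ⊓ constraints (φ ∘ suc) F ⊆ˢ P ⊓ constraints φ (outside ∷ F)
    constraints-∷⊆ P φ F x (x∈P , h) = x∈P , λ { ((suc e , there e∈F) , i) → h ((e , e∈F) , i) }

    constraints-∷⊇ : ∀ {m} P (φ : Fin (suc m) → Fin k → LinearForm A) s F →
      P ⊓ constraints φ (s ∷ F) ⊆ˢ P ⊓ constraints (φ ∘ suc) F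
    constraints-∷⊇ P φ s F x (x∈P , h) = x∈P , λ ((e , e∈F) , i) → h ((suc e , there e∈F) , i)

    constraints-antitone : ∀ {m} P (φ : Fin m → Fin k → LinearForm A) {F F′} → F ⊆ F′ →
      P ⊓ constraints φ F′ ⊆ˢ P ⊓ constraints φ F
    constraints-antitone P φ F⊆F′ x (x∈P , h) = x∈P , λ ((e , e∈F) , i) → h ((e , F⊆F′ e∈F) , i)

    constraints-∪ : ∀ {m} P (φ : Fin m → Fin k → LinearForm A) F F′ x →
      P ⊓ constraints φ F ∋ x → P ⊓ constraints φ F′ ∋ x → P ⊓ constraints φ (F ∪ F′) ∋ x
    constraints-∪ P φ F F′ x (x∈P , h) (_ , h′) = x∈P , λ ((e , e∈) , i) → case x∈p∪q⁻ F F′ e∈ of λ where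
      (inj₁ e∈F)  → h  ((e , e∈F ) , i)
      (inj₂ e∈F′) → h′ ((e , e∈F′) , i)

    constrained : ∀ {m t} {P : Subspace A} → Basis P t → (φ : Fin m → Fin k → LinearForm A) →
                  ∀ F → ∃ λ t′ → Basis (P ⊓ constraints φ F) t′
    constrained {t = t} B φ []            = t , Basis-resp (λ x x∈P → x∈P , λ { ((() , _) , _) }) (λ _ → proj₁) B
    constrained {P = P} B φ (outside ∷ F) with constrained B (φ ∘ suc) F
    ... | t′ , B′ = t′ , Basis-resp (constraints-∷⊆ P φ F) (constraints-∷⊇ P φ outside F) B′
    constrained {P = P} B φ (inside ∷ F) with cut B (φ zero)
    ... | t₁ , B₁ , _ with constrained B₁ (φ ∘ suc) F
    ... | t′ , B′ = t′ , Basis-resp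
      (λ x ((x∈P , h₀) , h) → x∈P , λ { ((zero , here) , i) → h₀ i ; ((suc e , there e∈F) , i) → h ((e , e∈F) , i) })
      (λ x (x∈P , h) → (x∈P , λ i → h ((zero , here) , i)) , λ ((e , e∈F) , i) → h ((suc e , there e∈F) , i))
      B′

    -- A computed number, which makes the search for a violating set decidable; by `Basis-mono` it
    -- is comparable with the size of any other basis.
    dim : ∀ {m t} {P : Subspace A} → Basis P t → (Fin m → Fin k → LinearForm A) → Subset m → ℕ
    dim B φ F = proj₁ (constrained B φ F)

  open Rado public

  -- Choose φ e (choice e) one e at a time, so that the hypothesis is inherited by what remains.  If no choice
  -- works for the first e, every i has a set F_i violating it; F_i is tight and φ e i vanishes on its solution
  -- space.  Tight sets are closed under union, and the union of the F_i together with e violates the hypothesis.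
  independent-transversal : ∀ {A m k t} {P : Subspace A} → Basis P t →
    (φ : Fin m → Fin (suc k) → LinearForm A) →
    (∀ F s → Basis (P ⊓ constraints φ F) s → s ℕ.≤ ∣ ∁ F ∣) →
    ∃ λ (choice : Fin m → Fin (suc k)) → ∀ x → P ∋ x → (∀ e → φ e (choice e) · x ≈ 0#) → x ≋ 𝟎
  independent-transversal {m = zero} {t = zero}  B φ small = (λ ()) , λ x x∈P _ → coords-zero B x x∈P λ ()
  independent-transversal {m = zero} {t = suc t} B φ small =
    contradiction (small [] _ (proj₂ (constrained B φ []))) λ ()
  independent-transversal {A} {suc m} {k} {t} {P} B φ small
    with Fin.any? (λ i → ¬? (anySubset? (λ F → ∣ ∁ F ∣ ℕ.<? dim (proj₁ (proj₂ (cut₁ B (φ zero i)))) (φ ∘ suc) F)))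
  ... | yes (i , ∄F) = choice , λ x x∈P h →
          proj₂ rest x (x∈P , λ _ → h zero) (h ∘ suc)
    where
    B′ = proj₁ (proj₂ (cut₁ B (φ zero i)))
    rest : ∃ λ (ch : Fin m → Fin (suc k)) → ∀ x → P ⊓₁ φ zero i ∋ x → (∀ e → φ (suc e) (ch e) · x ≈ 0#) → x ≋ 𝟎
    rest = independent-transversal B′ (φ ∘ suc) λ F s Bs → ℕ.≤-trans
      (Basis-mono (λ _ x∈ → x∈) Bs (proj₂ (constrained B′ (φ ∘ suc) F)))
      (ℕ.≮⇒≥ λ violates → ∄F (F , violates))
    choice : Fin (suc m) → Fin (suc k)
    choice zero    = i
    choice (suc e) = proj₁ rest e
  -- Every φ e i vanishes on the solution space of the tight set, so adding e changes neither that
  -- space nor the number of elements left outside; the excess then contradicts `small` at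
  -- `inside ∷ F`.
  ... | no ∄i = contradiction
          (ℕ.≤-trans (proj₁ (proj₂ all-tight))
            (Basis-mono (λ x x∈ → proj₁ x∈ , λ { ((zero , here) , i) → proj₂ (proj₂ all-tight) i x x∈
                                               ; ((suc e , there e∈F) , i) → proj₂ x∈ ((e , e∈F) , i) })
              (proj₂ (constrained B φ′ _))
              (proj₂ (constrained B φ (inside ∷ proj₁ all-tight)))))
          (ℕ.<⇒≱ (s≤s (small (inside ∷ proj₁ all-tight) _ (proj₂ (constrained B φ _)))))
    where
    φ′ = φ ∘ suc
    Tight : Subset m → Set
    Tight F = ∣ ∁ F ∣ ℕ.< dim B φ′ F

    -- The first element lies in the complement of `outside ∷ F`, which accounts for the extra one.
    -- A tight set therefore has an excess of exactly one.
    almost-small : ∀ F → dim B φ′ F ℕ.≤ suc ∣ ∁ F ∣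
    almost-small F = small (outside ∷ F) _
      (Basis-resp (constraints-∷⊆ P φ F) (constraints-∷⊇ P φ outside F) (proj₂ (constrained B φ′ F)))

    Vanishes : Fin (suc k) → Subset m → Set _
    Vanishes i F = ∀ x → P ⊓ constraints φ′ F ∋ x → φ zero i · x ≈ 0#

    -- A set that violates the hypothesis after cutting by φ e i already does so before the cut, and
    -- then by exactly one. A cut that lowered the dimension would use up this excess, so φ e i
    -- vanishes.
    tight : ∀ i → ∃ λ F → Tight F × Vanishes i F
    tight i = F , F-tight , [ (λ φ≈0 → φ≈0) , (λ (s , eq , C) → contradiction (F-cut eq C) ℕ.1+n≰n) ]′
                              (vanishes-or-cuts (proj₂ (constrained B φ′ F)) (φ zero i))
      where
      B′ = proj₁ (proj₂ (cut₁ B (φ zero i)))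
      violating : ∃ λ F → ∣ ∁ F ∣ ℕ.< dim B′ φ′ F
      violating = decidable-stable (anySubset? λ F → ∣ ∁ F ∣ ℕ.<? dim B′ φ′ F) (λ ∄F → ∄i (i , ∄F))
      F = proj₁ violating
      F-tight : Tight F
      F-tight = ℕ.≤-trans (proj₂ violating)
        (Basis-mono (λ x ((x∈P , _) , h) → x∈P , h) (proj₂ (constrained B′ φ′ F)) (proj₂ (constrained B φ′ F)))
      F-cut : ∀ {s} → dim B φ′ F ≡ suc s → Basis (P ⊓ constraints φ′ F ⊓₁ φ zero i) s → s ℕ.< s
      F-cut {s} eq C = ℕ.≤-trans
        (ℕ.≤-trans (ℕ.≤-reflexive (≡.sym eq)) (almost-small F))
        (ℕ.≤-trans (proj₂ violating)
          (Basis-mono (λ x ((x∈P , h₀) , h) → (x∈P , h) , h₀) (proj₂ (constrained B′ φ′ F)) C))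

    tight-∪ : ∀ F F′ → Tight F → Tight F′ → Tight (F ∪ F′)
    tight-∪ F F′ tF tF′ = uncross-≤ (∣∁∣-modular F F′) tF tF′
      (modular (constraints-antitone P φ′ (p∩q⊆p F F′)) (constraints-antitone P φ′ (p∩q⊆q F F′)) (constraints-∪ P φ′ F F′)
        (proj₂ (constrained B φ′ F)) (proj₂ (constrained B φ′ F′))
        (proj₂ (constrained B φ′ (F ∩ F′))) (proj₂ (constrained B φ′ (F ∪ F′))))
      (almost-small (F ∩ F′))

    -- The union runs over a nonempty family, because the empty set may fail to be tight.
    all-tight-below : ∀ j (ι : Fin (suc j) → Fin (suc k)) → ∃ λ F → Tight F × (∀ i → Vanishes (ι i) F)
    all-tight-below zero    ι with tight (ι zero)
    ... | F , tF , vF = F , tF , λ { zero → vF }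
    all-tight-below (suc j) ι with tight (ι zero) | all-tight-below j (ι ∘ suc)
    ... | F , tF , vF | F′ , tF′ , vF′ = F ∪ F′ , tight-∪ F F′ tF tF′ , λ where
      zero    x x∈ → vF x (constraints-antitone P φ′ (p⊆p∪q F′) x x∈)
      (suc i) x x∈ → vF′ i x (constraints-antitone P φ′ (q⊆p∪q F F′) x x∈)

    all-tight : ∃ λ F → Tight F × (∀ i → Vanishes i F)
    all-tight = all-tight-below k (λ i → i)

  -- Dot products and bases adapted to given vectors.

  infix 8 _∙_
  _∙_ : ∀ {n} → (Fin n → Carrier) → (Fin n → Carrier) → Carrier
  f ∙ x = sum λ a → f a * x a

  ∙-comm : ∀ {n} (f x : Fin n → Carrier) → f ∙ x ≈ x ∙ f
  ∙-comm f x = sum-cong-≋ λ a → *-comm (f a) (x a)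

  ∙-congʳ : ∀ {n} (f : Fin n → Carrier) {x y} → x ≋ y → f ∙ x ≈ f ∙ y
  ∙-congʳ f x≋y = sum-cong-≋ λ a → *-congˡ (x≋y a)

  ∙-form : ∀ {n} → (Fin n → Carrier) → LinearForm (Fin n)
  ∙-form x = record
    { _·_    = _∙ x
    ; ·-cong = λ f≋g → sum-cong-≋ λ a → *-congʳ (f≋g a)
    ; linear = λ f s g → combination-linear f s g (λ a (_ : ⊤) → x a) tt
    }

  ∙-form-zero : ∀ {n} (f x : Fin n → Carrier) → f ≋ 𝟎 → f ∙ x ≈ 0#
  ∙-form-zero f x = ·-zero (∙-form x)

  -- A basis z (σ l), y i of Kⁿ together with its dual basis g l, f i, such that the z (σ l) span all z r, r ∈ rs.
  record AdaptedBasis {I : Set} {n} (z : I → Fin n → Carrier) (rs : List I) : Set (c ⊔ ℓ) where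
    field
      s t     : ℕ
      s+t≡n   : s ℕ.+ t ≡ n
      s≤∣rs∣  : s ℕ.≤ length rs
      σ       : Fin s → I
      σ∈rs    : ∀ l → σ l ∈ₗ rs
      g       : Fin s → Fin n → Carrier
      y f     : Fin t → Fin n → Carrier
      f∙y-≡   : ∀ i → f i ∙ y i ≈ 1#
      f∙y-≢   : ∀ {i j} → i ≢ j → f i ∙ y j ≈ 0#
      f∙z     : ∀ i {r} → r ∈ₗ rs → f i ∙ z r ≈ 0#
      g∙z-≡   : ∀ l → g l ∙ z (σ l) ≈ 1#
      g∙z-≢   : ∀ {l m} → l ≢ m → g l ∙ z (σ m) ≈ 0#
      decompose  : ∀ x a → x a ≈ combination (λ i → f i ∙ x) y a + combination (λ l → g l ∙ x) (z ∘ σ) a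

  ·-decompose : ∀ {I : Set} {n} {z : I → Fin n → Carrier} {rs} (B : AdaptedBasis z rs) →
    (let open AdaptedBasis B) → ∀ (φ : LinearForm (Fin n)) x →
    (∀ l → φ · z (σ l) ≈ 0#) → φ · x ≈ sum λ i → f i ∙ x * φ · y i
  ·-decompose {z = z} B φ x φz≈0 = begin
    φ · x
      ≈⟨ ·-cong φ (λ a → trans (decompose x a) (+-congˡ (sym (*-identityˡ _)))) ⟩
    φ · (λ a → combination (λ i → f i ∙ x) y a + 1# * combination (λ l → g l ∙ x) (z ∘ σ) a)
      ≈⟨ linear φ _ _ _ ⟩
    φ · combination (λ i → f i ∙ x) y + 1# * φ · combination (λ l → g l ∙ x) (z ∘ σ)
      ≈⟨ +-cong (·-combination φ (λ i → f i ∙ x) y) (*-identityˡ _) ⟩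
    sum (λ i → f i ∙ x * φ · y i) + φ · combination (λ l → g l ∙ x) (z ∘ σ)
      ≈⟨ +-congˡ (trans (·-combination φ (λ l → g l ∙ x) (z ∘ σ)) (sum-zero λ l → trans (*-congˡ (φz≈0 l)) (zeroʳ _))) ⟩
    sum (λ i → f i ∙ x * φ · y i) + 0#
      ≈⟨ +-identityʳ _ ⟩
    sum (λ i → f i ∙ x * φ · y i) ∎
    where open AdaptedBasis B

  -- Exchange process starting from the standard basis. If every f i kills `z r`, this vector is
  -- already spanned by the selected ones. Otherwise it replaces a y i with f i ∙ z r nonzero; its
  -- dual form is f i divided by that value, and multiples of f i are subtracted from the other
  -- forms so that they kill `z r`.
  adaptedBasis : ∀ {I : Set} {n} (z : I → Fin n → Carrier) rs → AdaptedBasis z rs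
  adaptedBasis {n = n} z [] = record
    { s = 0 ; t = n ; s+t≡n = ≡.refl ; s≤∣rs∣ = z≤n ; σ = λ () ; σ∈rs = λ () ; g = λ ()
    ; y = δ ; f = δ
    ; f∙y-≡ = λ i → trans (δ∙ (δ i) i) (δ-refl i)
    ; f∙y-≢ = λ {i} {j} i≢j → trans (δ∙ (δ j) i) (δ-≢ (i≢j ∘ ≡.sym))
    ; f∙z = λ i ()
    ; g∙z-≡ = λ () ; g∙z-≢ = λ { {()} }
    ; decompose = λ x a → sym (begin
        combination (λ i → δ i ∙ x) δ a + 0#   ≈⟨ +-identityʳ _ ⟩
        combination (λ i → δ i ∙ x) δ a        ≈⟨ sum-single a (λ i i≢a → trans (*-congˡ (δ-≢ i≢a)) (zeroʳ _)) ⟩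
        δ a ∙ x * δ a a                        ≈⟨ *-cong (δ∙ x a) (δ-refl a) ⟩
        x a * 1#                               ≈⟨ *-identityʳ _ ⟩
        x a                                    ∎)
    }
    where
    δ∙ : ∀ {n} (x : Fin n → Carrier) i → δ i ∙ x ≈ x i
    δ∙ x i = trans (sum-single i λ a a≢i → trans (*-congʳ (δ-≢ (a≢i ∘ ≡.sym))) (zeroˡ _))
                   (trans (*-congʳ (δ-refl i)) (*-identityˡ _))
  adaptedBasis {n = n} z (r ∷ rs) = extend (adaptedBasis z rs)
    where
    extend : AdaptedBasis z rs → AdaptedBasis z (r ∷ rs)
    extend B with Fin.any? (λ i → ¬? ((AdaptedBasis.f B i ∙ z r) ≟ 0#))
    ... | no  f∙z≈0 = record
      { AdaptedBasis B
      ; s≤∣rs∣ = ℕ.m≤n⇒m≤1+n (AdaptedBasis.s≤∣rs∣ B)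
      ; σ∈rs   = λ l → Any.there (AdaptedBasis.σ∈rs B l)
      ; f∙z    = λ where
          i (Any.here ≡.refl) → decidable-stable ((AdaptedBasis.f B i ∙ z r) ≟ 0#) λ f∙z≉0 → f∙z≈0 (i , f∙z≉0)
          i (Any.there r∈)    → AdaptedBasis.f∙z B i r∈
      }
    extend record { s = s ; t = suc t ; s+t≡n = s+t≡n ; s≤∣rs∣ = s≤∣rs∣ ; σ = σ ; σ∈rs = σ∈rs ; g = g ; y = y ; f = f
                  ; f∙y-≡ = f∙y-≡ ; f∙y-≢ = f∙y-≢ ; f∙z = f∙z ; g∙z-≡ = g∙z-≡ ; g∙z-≢ = g∙z-≢ ; decompose = decompose }
      | yes (i , e≉0) = record
      { s      = suc s
      ; t      = t
      ; s+t≡n  = ≡.trans (≡.sym (ℕ.+-suc s t)) s+t≡n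
      ; s≤∣rs∣ = s≤s s≤∣rs∣
      ; σ      = σ′
      ; σ∈rs   = λ { zero → Any.here ≡.refl ; (suc l) → Any.there (σ∈rs l) }
      ; g      = g′
      ; y      = y ∘ punchIn i
      ; f      = λ j → eliminate (f (punchIn i j))
      ; f∙y-≡  = λ j → trans (eliminate-∙-zero (f (punchIn i j)) (f∙y-≢ (Fin.punchInᵢ≢i i j ∘ ≡.sym))) (f∙y-≡ _)
      ; f∙y-≢  = λ {j} {k} j≢k → trans (eliminate-∙-zero (f (punchIn i j)) (f∙y-≢ (Fin.punchInᵢ≢i i k ∘ ≡.sym)))
                                   (f∙y-≢ (j≢k ∘ Fin.punchIn-injective i j k))
      ; f∙z    = λ where
          j (Any.here ≡.refl) → eliminate-∙-p (f (punchIn i j))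
          j (Any.there r∈)    → trans (eliminate-∙-zero (f (punchIn i j)) (f∙z i r∈)) (f∙z (punchIn i j) r∈)
      ; g∙z-≡  = λ where
          zero    → trans (scaled-∙ (z r)) (trans (*-comm _ _) e*u≈1)
          (suc l) → trans (eliminate-∙-zero (g l) (f∙z i (σ∈rs l))) (g∙z-≡ l)
      ; g∙z-≢  = g′∙z-≢ _ _
      -- Expanding `p` in the old basis gives e y_i = p - B - D; this is substituted for y_i in the
      -- old expansion of x.
      ; decompose = λ x a → let
          w = - (u * f i ∙ x)
          A = combination (λ j → f (punchIn i j) ∙ x) (y ∘ punchIn i) a
          B = combination (λ j → f (punchIn i j) ∙ p) (y ∘ punchIn i) a
          C = combination (λ l → g l ∙ x) (z ∘ σ) a
          D = combination (λ l → g l ∙ p) (z ∘ σ) a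
        in begin
          x a
            ≈⟨ decompose x a ⟩
          combination (λ j → f j ∙ x) y a + C
            ≈⟨ +-congʳ (sum-remove {i = i} (λ j → f j ∙ x * y j a)) ⟩
          f i ∙ x * y i a + A + C
            ≈⟨ +-congʳ (+-congʳ (trans (*-congˡ e*u≈1) (*-identityʳ _))) ⟨
          f i ∙ x * y i a * (e * u) + A + C
            ≈⟨ solve 8 (λ c y e u A B C D → c :* y :* (e :* u) :+ A :+ C :=
                 (A :+ :- (u :* c) :* B) :+ (u :* c :* (e :* y :+ B :+ D) :+ (C :+ :- (u :* c) :* D)))
                 refl (f i ∙ x) (y i a) e u A B C D ⟩
          (A + w * B) + (u * f i ∙ x * (e * y i a + B + D) + (C + w * D))
            ≈⟨ +-congˡ (+-congʳ (*-congˡ (begin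
                 p a                                  ≈⟨ decompose p a ⟩
                 combination (λ j → f j ∙ p) y a + D  ≈⟨ +-congʳ (sum-remove {i = i} (λ j → f j ∙ p * y j a)) ⟩
                 e * y i a + B + D                    ∎))) ⟨
          (A + w * B) + (u * f i ∙ x * p a + (C + w * D))
            ≈⟨ +-cong (eliminated (f ∘ punchIn i) (y ∘ punchIn i) x a)
                 (+-cong (*-congʳ (scaled-∙ x)) (eliminated g (z ∘ σ) x a)) ⟨
          combination (λ j → eliminate (f (punchIn i j)) ∙ x) (y ∘ punchIn i) a
            + combination (λ l → g′ l ∙ x) (z ∘ σ′) a ∎
      }
      where
      p = z r
      e = f i ∙ p
      u = proj₁ (inverse e e≉0)
      e*u≈1 : e * u ≈ 1#
      e*u≈1 = proj₂ (inverse e e≉0)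
      eliminate : (Fin n → Carrier) → Fin n → Carrier
      eliminate h a = h a + - (h ∙ p * u) * f i a
      scaled : Fin n → Carrier
      scaled a = u * f i a
      g′ : Fin (suc s) → Fin n → Carrier
      g′ zero    = scaled
      g′ (suc l) = eliminate (g l)
      σ′ : Fin (suc s) → _
      σ′ zero    = r
      σ′ (suc l) = σ l
      scaled-∙ : ∀ x → scaled ∙ x ≈ u * f i ∙ x
      scaled-∙ x = trans (sum-cong-≋ λ a → *-assoc u (f i a) (x a)) (sym (*-distribˡ-sum u (λ a → f i a * x a)))
      eliminate-∙ : ∀ h x → eliminate h ∙ x ≈ h ∙ x + - (h ∙ p * u) * f i ∙ x
      eliminate-∙ h x = linear (∙-form x) h _ (f i)
      eliminate-∙-zero : ∀ h {x} → f i ∙ x ≈ 0# → eliminate h ∙ x ≈ h ∙ x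
      eliminate-∙-zero h {x} fx≈0 = trans (eliminate-∙ h x)
        (trans (+-congˡ (trans (*-congˡ fx≈0) (zeroʳ _))) (+-identityʳ _))
      eliminate-∙-p : ∀ h → eliminate h ∙ p ≈ 0#
      eliminate-∙-p h = begin
        eliminate h ∙ p                ≈⟨ eliminate-∙ h p ⟩
        h ∙ p + - (h ∙ p * u) * e      ≈⟨ solve 3 (λ h u e → h :+ :- (h :* u) :* e := h :- h :* (e :* u)) refl (h ∙ p) u e ⟩
        h ∙ p - h ∙ p * (e * u)        ≈⟨ +-congˡ (-‿cong (trans (*-congˡ e*u≈1) (*-identityʳ _))) ⟩
        h ∙ p - h ∙ p                  ≈⟨ -‿inverseʳ _ ⟩
        0#                             ∎
      g′∙z-≢ : ∀ l m → l ≢ m → g′ l ∙ z (σ′ m) ≈ 0#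
      g′∙z-≢ zero    zero    0≢0 = contradiction ≡.refl 0≢0
      g′∙z-≢ zero    (suc m) _   = trans (scaled-∙ (z (σ m))) (trans (*-congˡ (f∙z i (σ∈rs m))) (zeroʳ _))
      g′∙z-≢ (suc l) zero    _   = eliminate-∙-p (g l)
      g′∙z-≢ (suc l) (suc m) l≢m = trans (eliminate-∙-zero (g l) (f∙z i (σ∈rs m))) (g∙z-≢ (l≢m ∘ ≡.cong suc))
      eliminated : ∀ {m} (h v : Fin m → Fin n → Carrier) x a →
        combination (λ j → eliminate (h j) ∙ x) v a
          ≈ combination (λ j → h j ∙ x) v a + - (u * f i ∙ x) * combination (λ j → h j ∙ p) v a
      eliminated h v x a = trans
        (sum-cong-≋ λ j → *-congʳ (trans (eliminate-∙ (h j) x) (+-congˡ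
          (solve 3 (λ hp u fx → :- (hp :* u) :* fx := :- (u :* fx) :* hp) refl (h j ∙ p) u (f i ∙ x)))))
        (combination-linear (λ j → h j ∙ x) _ (λ j → h j ∙ p) v a)

-- Exterior algebra in coordinates.

module BodyBar {c ℓ₁ ℓ₂} (ℝ : CompleteOrderedField c ℓ₁ ℓ₂) where

  open Framework ℝ
  open CompleteOrderedField ℝ using (1≉0; inverse; isDecTotalOrder; commutativeRing)
  open IsDecTotalOrder isDecTotalOrder using (_≟_)
  open CommutativeRing commutativeRing hiding (zero)
  open RingProperties ring using (-1*x≈-x; -0#≈0#; -‿distribˡ-*)
  open RawSemiringDefs (Semiring.rawSemiring semiring) using (_^_)
  open LinearAlgebra commutativeRing _≟_ 1≉0 inverse
  open ℤ-Solver commutativeRing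
  open SetoidReasoning setoid

  e-refl : ∀ {n} (I : Subset n) → e I I ≈ 1#
  e-refl I rewrite dec-true (Vec.≡-dec Bool._≟_ I I) ≡.refl = refl

  e-≢ : ∀ {n} {I J : Subset n} → I ≢ J → e I J ≈ 0#
  e-≢ {I = I} {J} I≢J rewrite dec-false (Vec.≡-dec Bool._≟_ I J) I≢J = refl

  sumOverSubsets-cong : ∀ {n} {f g : Subset n → Carrier} → f ≋ g → sumOverSubsets n f ≈ sumOverSubsets n g
  sumOverSubsets-cong {zero}  f≋g = f≋g []
  sumOverSubsets-cong {suc n} f≋g =
    +-cong (sumOverSubsets-cong (f≋g ∘ (outside ∷_))) (sumOverSubsets-cong (f≋g ∘ (inside ∷_)))

  sumOverSubsets-linear : ∀ {n} (f : Subset n → Carrier) s g →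
    sumOverSubsets n (λ I → f I + s * g I) ≈ sumOverSubsets n f + s * sumOverSubsets n g
  sumOverSubsets-linear {zero}  f s g = refl
  sumOverSubsets-linear {suc n} f s g = trans
    (+-cong (sumOverSubsets-linear (f ∘ (outside ∷_)) s _) (sumOverSubsets-linear (f ∘ (inside ∷_)) s _))
    (solve 5 (λ a b x y s → (a :+ s :* b) :+ (x :+ s :* y) := (a :+ x) :+ s :* (b :+ y)) refl _ _ _ _ s)

  sumOverSubsets-zero : ∀ {n} {f : Subset n → Carrier} → f ≋ 𝟎 → sumOverSubsets n f ≈ 0#
  sumOverSubsets-zero {zero}  f≋0 = f≋0 []
  sumOverSubsets-zero {suc n} f≋0 = trans
    (+-cong (sumOverSubsets-zero (f≋0 ∘ (outside ∷_))) (sumOverSubsets-zero (f≋0 ∘ (inside ∷_)))) (+-identityʳ 0#)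

  sumOverSubsets-single : ∀ {n} {f : Subset n → Carrier} I → (∀ J → J ≢ I → f J ≈ 0#) → sumOverSubsets n f ≈ f I
  sumOverSubsets-single []            f≈0 = refl
  sumOverSubsets-single {suc n} {f} (outside ∷ I) f≈0 = trans
    (+-cong (sumOverSubsets-single I λ J J≢I → f≈0 (outside ∷ J) (J≢I ∘ Vec.∷-injectiveʳ))
            (sumOverSubsets-zero {n} λ J → f≈0 (inside ∷ J) λ ()))
    (+-identityʳ _)
  sumOverSubsets-single {suc n} {f} (inside ∷ I)  f≈0 = trans
    (+-cong (sumOverSubsets-zero {n} λ J → f≈0 (outside ∷ J) λ ())
            (sumOverSubsets-single I λ J J≢I → f≈0 (inside ∷ J) (J≢I ∘ Vec.∷-injectiveʳ)))
    (+-identityˡ _)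

  sumOverSubsets-∁ : ∀ {n} (f : Subset n → Carrier) → sumOverSubsets n (f ∘ ∁) ≈ sumOverSubsets n f
  sumOverSubsets-∁ {zero}  f = refl
  sumOverSubsets-∁ {suc n} f = trans
    (+-cong (sumOverSubsets-∁ (f ∘ (inside ∷_))) (sumOverSubsets-∁ (f ∘ (outside ∷_)))) (+-comm _ _)

  inner-comm : ∀ {n} (a b : Λ n) → inner a b ≈ inner b a
  inner-comm a b = sumOverSubsets-cong λ I → *-comm (a I) (b I)

  inner-form : ∀ {n} → Λ n → LinearForm (Subset n)
  inner-form b = record
    { _·_    = λ a → inner a b
    ; ·-cong = λ a≋a′ → sumOverSubsets-cong λ I → *-congʳ (a≋a′ I)
    ; linear = λ a s a′ → trans
        (sumOverSubsets-cong λ I →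
          solve 4 (λ a s a′ b → (a :+ s :* a′) :* b := a :* b :+ s :* (a′ :* b)) refl (a I) s (a′ I) (b I))
        (sumOverSubsets-linear (λ I → a I * b I) s _)
    }

  inner-combination : ∀ {n} s (a : Λ n) t b c →
    inner (λ I → s * a I + t * b I) c ≈ s * inner a c + t * inner b c
  inner-combination s a t b c = begin
    inner (λ I → s * a I + t * b I) c
      ≈⟨ ·-cong (inner-form c) (λ I → +-congʳ (sym (+-identityˡ _))) ⟩
    inner (λ I → 0# + s * a I + t * b I) c
      ≈⟨ linear (inner-form c) _ t b ⟩
    inner (λ I → 0# + s * a I) c + t * inner b c
      ≈⟨ +-congʳ (linear (inner-form c) 𝟎 s a) ⟩
    inner 𝟎 c + s * inner a c + t * inner b c
      ≈⟨ +-congʳ (trans (+-congʳ (·-zero (inner-form c) λ _ → refl)) (+-identityˡ _)) ⟩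
    s * inner a c + t * inner b c ∎

  inner-combinationʳ : ∀ {n} s (a : Λ n) t b c →
    inner c (λ I → s * a I + t * b I) ≈ s * inner c a + t * inner c b
  inner-combinationʳ s a t b c = trans (inner-comm c _)
    (trans (inner-combination s a t b c) (+-cong (*-congˡ (inner-comm a c)) (*-congˡ (inner-comm b c))))

  involute-cong : ∀ {n} {a b : Λ n} → a ≋ b → involute a ≋ involute b
  involute-cong a≋b I = *-congˡ (a≋b I)

  ∧-cong : ∀ {n} {a a′ b b′ : Λ n} → a ≋ a′ → b ≋ b′ → a ∧ b ≋ a′ ∧ b′
  ∧-cong {zero}  a≋a′ b≋b′ []            = *-cong (a≋a′ []) (b≋b′ [])
  ∧-cong {suc n} a≋a′ b≋b′ (outside ∷ I) = ∧-cong (a≋a′ ∘ (outside ∷_)) (b≋b′ ∘ (outside ∷_)) I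
  ∧-cong {suc n} a≋a′ b≋b′ (inside  ∷ I) = +-cong
    (∧-cong (a≋a′ ∘ (inside ∷_)) (b≋b′ ∘ (outside ∷_)) I)
    (∧-cong (involute-cong (a≋a′ ∘ (outside ∷_))) (b≋b′ ∘ (inside ∷_)) I)

  ∧-scaleˡ : ∀ {n} s (a b : Λ n) I → ((λ J → s * a J) ∧ b) I ≈ s * (a ∧ b) I
  ∧-scaleˡ {zero}  s a b []            = *-assoc s _ _
  ∧-scaleˡ {suc n} s a b (outside ∷ I) = ∧-scaleˡ s (a ∘ (outside ∷_)) _ I
  ∧-scaleˡ {suc n} s a b (inside  ∷ I) = trans
    (+-cong (∧-scaleˡ s (a ∘ (inside ∷_)) _ I)
            (trans (∧-cong (λ J → solve 3 (λ ε s a → ε :* (s :* a) := s :* (ε :* a)) refl ((- 1#) ^ ∣ J ∣) s (a (outside ∷ J))) (λ _ → refl) I)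
                   (∧-scaleˡ s (involute (a ∘ (outside ∷_))) _ I)))
    (sym (distribˡ s _ _))

  ∧-scaleʳ : ∀ {n} s (a b : Λ n) I → (a ∧ (λ J → s * b J)) I ≈ s * (a ∧ b) I
  ∧-scaleʳ {zero}  s a b []            = solve 3 (λ s a b → a :* (s :* b) := s :* (a :* b)) refl s _ _
  ∧-scaleʳ {suc n} s a b (outside ∷ I) = ∧-scaleʳ s (a ∘ (outside ∷_)) _ I
  ∧-scaleʳ {suc n} s a b (inside  ∷ I) = trans
    (+-cong (∧-scaleʳ s (a ∘ (inside ∷_)) _ I) (∧-scaleʳ s (involute (a ∘ (outside ∷_))) _ I))
    (sym (distribˡ s _ _))

  ∧-zeroˡ : ∀ {n} {a : Λ n} (b : Λ n) → a ≋ 𝟎 → a ∧ b ≋ 𝟎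
  ∧-zeroˡ {a = a} b a≋0 I = trans
    (∧-cong (λ J → trans (a≋0 J) (sym (zeroˡ (a J)))) (λ _ → refl) I) (trans (∧-scaleˡ 0# a b I) (zeroˡ _))

  ∧-zeroʳ : ∀ {n} (a : Λ n) {b : Λ n} → b ≋ 𝟎 → a ∧ b ≋ 𝟎
  ∧-zeroʳ a {b} b≋0 I = trans
    (∧-cong (λ _ → refl) (λ J → trans (b≋0 J) (sym (zeroˡ (b J)))) I) (trans (∧-scaleʳ 0# a b I) (zeroˡ _))

  involute-e : ∀ {n} (I : Subset n) → involute (e I) ≋ λ J → (- 1#) ^ ∣ I ∣ * e I J
  involute-e I J with Vec.≡-dec Bool._≟_ I J
  ... | yes ≡.refl = refl
  ... | no  _      = trans (zeroʳ _) (sym (zeroʳ _))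

  involute-e⊥ : ∀ {n} → involute (e {n} ⊥) ≋ e ⊥
  involute-e⊥ {n} J = trans (involute-e ⊥ J) (trans (*-congʳ (reflexive (≡.cong ((- 1#) ^_) (∣⊥∣≡0 n)))) (*-identityˡ _))

  e⊥-∧ : ∀ {n} (b : Λ n) → e ⊥ ∧ b ≋ b
  e⊥-∧ {zero}  b []            = *-identityˡ _
  e⊥-∧ {suc n} b (outside ∷ I) = e⊥-∧ (b ∘ (outside ∷_)) I
  e⊥-∧ {suc n} b (inside  ∷ I) = begin
    (𝟎 ∧ (b ∘ (outside ∷_))) I + (involute (e ⊥) ∧ (b ∘ (inside ∷_))) I
      ≈⟨ +-cong (∧-zeroˡ _ (λ _ → refl) I) (∧-cong involute-e⊥ (λ _ → refl) I) ⟩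
    0# + (e ⊥ ∧ (b ∘ (inside ∷_))) I
      ≈⟨ +-identityˡ _ ⟩
    (e ⊥ ∧ (b ∘ (inside ∷_))) I
      ≈⟨ e⊥-∧ (b ∘ (inside ∷_)) I ⟩
    b (inside ∷ I) ∎

  ∧-e⊥ : ∀ {n} (a : Λ n) → a ∧ e ⊥ ≋ a
  ∧-e⊥ {zero}  a []            = *-identityʳ _
  ∧-e⊥ {suc n} a (outside ∷ I) = ∧-e⊥ (a ∘ (outside ∷_)) I
  ∧-e⊥ {suc n} a (inside  ∷ I) = trans
    (+-cong (∧-e⊥ (a ∘ (inside ∷_)) I) (∧-zeroʳ (involute (a ∘ (outside ∷_))) (λ _ → refl) I)) (+-identityʳ _)

  vector-outside : ∀ {n} (x : Vector Carrier (suc n)) I → vector x (outside ∷ I) ≈ vector (x ∘ suc) I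
  vector-outside x I = trans (+-congʳ (zeroʳ _)) (+-identityˡ _)

  vector-inside : ∀ {n} (x : Vector Carrier (suc n)) I → vector x (inside ∷ I) ≈ x zero * e ⊥ I
  vector-inside {n} x I = trans (+-congˡ (sum-zero {n} λ i → zeroʳ (x (suc i)))) (+-identityʳ _)

  vector-grade : ∀ {n} (x : Vector Carrier n) I → ∣ I ∣ ≢ 1 → vector x I ≈ 0#
  vector-grade x []            _   = refl
  vector-grade x (outside ∷ I) ≢1 = trans (vector-outside x I) (vector-grade (x ∘ suc) I ≢1)
  vector-grade {suc n} x (inside  ∷ I) ≢1 = trans (vector-inside x I)
    (trans (*-congˡ (e-≢ {I = ⊥} {I} λ ⊥≡I → ≢1 (≡.cong suc (≡.trans (≡.cong ∣_∣ (≡.sym ⊥≡I)) (∣⊥∣≡0 n))))) (zeroʳ _))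

  involute-vector : ∀ {n} (x : Vector Carrier n) → involute (vector x) ≋ λ I → - vector x I
  involute-vector x I with ∣ I ∣ ℕ.≟ 1
  ... | yes ∣I∣≡1 = trans (*-congʳ (trans (reflexive (≡.cong ((- 1#) ^_) ∣I∣≡1)) (*-identityʳ _))) (-1*x≈-x _)
  ... | no  ∣I∣≢1 = trans (*-congˡ (vector-grade x I ∣I∣≢1))
                     (trans (zeroʳ _) (sym (trans (-‿cong (vector-grade x I ∣I∣≢1)) -0#≈0#)))

  infix 7 _∧ᵥ_
  _∧ᵥ_ : ∀ {n} → Vector Carrier n → Vector Carrier n → Λ n
  x ∧ᵥ y = vector x ∧ vector y

  ∧ᵥ-outside : ∀ {n} (x y : Vector Carrier (suc n)) I → (x ∧ᵥ y) (outside ∷ I) ≈ ((x ∘ suc) ∧ᵥ (y ∘ suc)) I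
  ∧ᵥ-outside x y = ∧-cong (vector-outside x) (vector-outside y)

  -- With x = x₀ e₀ + x′ and y = y₀ e₀ + y′, moving e₀ to the front past x′ costs the sign that
  -- `involute` records. Together with `∧ᵥ-outside` this reduces the later facts about x ∧ y to
  -- inductions on `n`.
  ∧ᵥ-inside : ∀ {n} (x y : Vector Carrier (suc n)) I →
    (x ∧ᵥ y) (inside ∷ I) ≈ x zero * vector (y ∘ suc) I + - y zero * vector (x ∘ suc) I
  ∧ᵥ-inside x y I = +-cong
    (begin
      ((vector x ∘ (inside ∷_)) ∧ (vector y ∘ (outside ∷_))) I
        ≈⟨ ∧-cong (vector-inside x) (vector-outside y) I ⟩
      ((λ J → x zero * e ⊥ J) ∧ vector (y ∘ suc)) I
        ≈⟨ ∧-scaleˡ (x zero) (e ⊥) _ I ⟩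
      x zero * (e ⊥ ∧ vector (y ∘ suc)) I
        ≈⟨ *-congˡ (e⊥-∧ _ I) ⟩
      x zero * vector (y ∘ suc) I ∎)
    (begin
      (involute (vector x ∘ (outside ∷_)) ∧ (vector y ∘ (inside ∷_))) I
        ≈⟨ ∧-cong (λ J → trans (involute-cong (vector-outside x) J) (involute-vector (x ∘ suc) J)) (vector-inside y) I ⟩
      ((λ J → - vector (x ∘ suc) J) ∧ (λ J → y zero * e ⊥ J)) I
        ≈⟨ ∧-scaleʳ (y zero) _ (e ⊥) I ⟩
      y zero * ((λ J → - vector (x ∘ suc) J) ∧ e ⊥) I
        ≈⟨ *-congˡ (∧-e⊥ _ I) ⟩
      y zero * - vector (x ∘ suc) I
        ≈⟨ solve 2 (λ y v → y :* :- v := :- y :* v) refl _ _ ⟩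
      - y zero * vector (x ∘ suc) I ∎)

  ∧ᵥ-grade : ∀ {n} (x y : Vector Carrier n) I → ∣ I ∣ ≢ 2 → (x ∧ᵥ y) I ≈ 0#
  ∧ᵥ-grade x y []            _  = zeroˡ _
  ∧ᵥ-grade x y (outside ∷ I) ≢2 = trans (∧ᵥ-outside x y I) (∧ᵥ-grade (x ∘ suc) (y ∘ suc) I ≢2)
  ∧ᵥ-grade x y (inside  ∷ I) ≢2 = trans (∧ᵥ-inside x y I) (trans
    (+-cong (trans (*-congˡ (vector-grade (y ∘ suc) I (≢2 ∘ ≡.cong suc))) (zeroʳ _))
            (trans (*-congˡ (vector-grade (x ∘ suc) I (≢2 ∘ ≡.cong suc))) (zeroʳ _)))
    (+-identityʳ 0#))

  vector-linear : ∀ {n} (x : Vector Carrier n) s y I → vector (λ i → x i + s * y i) I ≈ vector x I + s * vector y I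
  vector-linear x s y I = combination-linear x s y (λ i → e ⁅ i ⁆) I

  ∧ᵥ-linear : ∀ {n} (x y : Vector Carrier n) s z I →
    (x ∧ᵥ (λ i → y i + s * z i)) I ≈ (x ∧ᵥ y) I + s * (x ∧ᵥ z) I
  ∧ᵥ-linear x y s z []            = trans (zeroˡ _) (sym (trans (+-cong (zeroˡ _) (trans (*-congˡ (zeroˡ _)) (zeroʳ s))) (+-identityʳ 0#)))
  ∧ᵥ-linear x y s z (outside ∷ I) = trans (∧ᵥ-outside x (λ i → y i + s * z i) I)
    (trans (∧ᵥ-linear (x ∘ suc) (y ∘ suc) s (z ∘ suc) I)
           (sym (+-cong (∧ᵥ-outside x y I) (*-congˡ (∧ᵥ-outside x z I)))))
  ∧ᵥ-linear x y s z (inside  ∷ I) = begin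
    (x ∧ᵥ (λ i → y i + s * z i)) (inside ∷ I)
      ≈⟨ ∧ᵥ-inside x (λ i → y i + s * z i) I ⟩
    x zero * vector (λ i → y (suc i) + s * z (suc i)) I + - (y zero + s * z zero) * vector (x ∘ suc) I
      ≈⟨ +-congʳ (*-congˡ (vector-linear (y ∘ suc) s (z ∘ suc) I)) ⟩
    x zero * (vector (y ∘ suc) I + s * vector (z ∘ suc) I) + - (y zero + s * z zero) * vector (x ∘ suc) I
      ≈⟨ solve 7 (λ x y s z X Y Z → x :* (Y :+ s :* Z) :+ :- (y :+ s :* z) :* X :=
           (x :* Y :+ :- y :* X) :+ s :* (x :* Z :+ :- z :* X)) refl (x zero) (y zero) s (z zero) _ _ _ ⟩
    (x zero * vector (y ∘ suc) I + - y zero * vector (x ∘ suc) I)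
      + s * (x zero * vector (z ∘ suc) I + - z zero * vector (x ∘ suc) I)
      ≈⟨ +-cong (∧ᵥ-inside x y I) (*-congˡ (∧ᵥ-inside x z I)) ⟨
    (x ∧ᵥ y) (inside ∷ I) + s * (x ∧ᵥ z) (inside ∷ I) ∎

  ∧ᵥ-antisym : ∀ {n} (x y : Vector Carrier n) I → (x ∧ᵥ y) I ≈ - (y ∧ᵥ x) I
  ∧ᵥ-antisym x y []            = trans (zeroˡ _) (sym (trans (-‿cong (zeroˡ _)) -0#≈0#))
  ∧ᵥ-antisym x y (outside ∷ I) = trans (∧ᵥ-outside x y I)
    (trans (∧ᵥ-antisym (x ∘ suc) (y ∘ suc) I) (-‿cong (sym (∧ᵥ-outside y x I))))
  ∧ᵥ-antisym x y (inside  ∷ I) = begin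
    (x ∧ᵥ y) (inside ∷ I)
      ≈⟨ ∧ᵥ-inside x y I ⟩
    x zero * vector (y ∘ suc) I + - y zero * vector (x ∘ suc) I
      ≈⟨ solve 4 (λ x y X Y → x :* Y :+ :- y :* X := :- (y :* X :+ :- x :* Y)) refl (x zero) (y zero) _ _ ⟩
    - (y zero * vector (x ∘ suc) I + - x zero * vector (y ∘ suc) I)
      ≈⟨ -‿cong (∧ᵥ-inside y x I) ⟨
    - (y ∧ᵥ x) (inside ∷ I) ∎

  inner-vector : ∀ {n} (f x : Vector Carrier n) → inner (vector f) (vector x) ≈ f ∙ x
  inner-vector {zero}  f x = zeroˡ _
  inner-vector {suc n} f x = begin
    sumOverSubsets n (λ I → vector f (outside ∷ I) * vector x (outside ∷ I))
      + sumOverSubsets n (λ I → vector f (inside ∷ I) * vector x (inside ∷ I))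
      ≈⟨ +-cong
           (trans (sumOverSubsets-cong λ I → *-cong (vector-outside f I) (vector-outside x I)) (inner-vector (f ∘ suc) (x ∘ suc)))
           (trans (sumOverSubsets-cong λ I → *-cong (vector-inside f I) (vector-inside x I))
             (trans (sumOverSubsets-single {n} {λ I → f zero * e ⊥ I * (x zero * e ⊥ I)} ⊥ λ J J≢⊥ →
                      trans (*-congʳ (trans (*-congˡ (e-≢ (J≢⊥ ∘ ≡.sym))) (zeroʳ _))) (zeroˡ _))
               (*-cong (trans (*-congˡ (e-refl {n} ⊥)) (*-identityʳ _)) (trans (*-congˡ (e-refl {n} ⊥)) (*-identityʳ _))))) ⟩
    (f ∘ suc) ∙ (x ∘ suc) + f zero * x zero
      ≈⟨ +-comm _ _ ⟩
    f ∙ x ∎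

  -- Reads the bivector f ∧ g as an alternating form in x and y. If f and g both kill x, then x lies
  -- in its radical; this is how pins are respected in `Necessity`.
  cauchy-binet : ∀ {n} (f g x y : Vector Carrier n) → inner (f ∧ᵥ g) (x ∧ᵥ y) ≈ f ∙ x * g ∙ y - f ∙ y * g ∙ x
  cauchy-binet {zero}  f g x y = trans (trans (*-congʳ (zeroˡ _)) (zeroˡ _)) (sym (-‿inverseʳ _))
  cauchy-binet {suc n} f g x y = begin
    sumOverSubsets n (λ I → (f ∧ᵥ g) (outside ∷ I) * (x ∧ᵥ y) (outside ∷ I))
      + sumOverSubsets n (λ I → (f ∧ᵥ g) (inside ∷ I) * (x ∧ᵥ y) (inside ∷ I))
      ≈⟨ +-cong
           (trans (sumOverSubsets-cong λ I → *-cong (∧ᵥ-outside f g I) (∧ᵥ-outside x y I)) (cauchy-binet f′ g′ x′ y′))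
           (sumOverSubsets-cong λ I → *-cong (∧ᵥ-inside f g I) (∧ᵥ-inside x y I)) ⟩
    (f′ ∙ x′ * g′ ∙ y′ - f′ ∙ y′ * g′ ∙ x′)
      + inner (λ I → f₀ * vector g′ I + - g₀ * vector f′ I) (λ I → x₀ * vector y′ I + - y₀ * vector x′ I)
      ≈⟨ +-congˡ (trans (inner-combination f₀ (vector g′) (- g₀) (vector f′) _) (+-cong (*-congˡ (expanded g′)) (*-congˡ (expanded f′)))) ⟩
    (f′ ∙ x′ * g′ ∙ y′ - f′ ∙ y′ * g′ ∙ x′)
      + (f₀ * (x₀ * g′ ∙ y′ + - y₀ * g′ ∙ x′) + - g₀ * (x₀ * f′ ∙ y′ + - y₀ * f′ ∙ x′))
      ≈⟨ solve 8 (λ f₀ g₀ x₀ y₀ fx fy gx gy →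
           (fx :* gy :- fy :* gx) :+ (f₀ :* (x₀ :* gy :+ :- y₀ :* gx) :+ :- g₀ :* (x₀ :* fy :+ :- y₀ :* fx)) :=
           (f₀ :* x₀ :+ fx) :* (g₀ :* y₀ :+ gy) :- (f₀ :* y₀ :+ fy) :* (g₀ :* x₀ :+ gx))
           refl f₀ g₀ x₀ y₀ (f′ ∙ x′) (f′ ∙ y′) (g′ ∙ x′) (g′ ∙ y′) ⟩
    f ∙ x * g ∙ y - f ∙ y * g ∙ x ∎
    where
    f₀ = f zero ; g₀ = g zero ; x₀ = x zero ; y₀ = y zero
    f′ = f ∘ suc ; g′ = g ∘ suc ; x′ = x ∘ suc ; y′ = y ∘ suc
    expanded : ∀ h → inner (vector h) (λ I → x₀ * vector y′ I + - y₀ * vector x′ I) ≈ x₀ * h ∙ y′ + - y₀ * h ∙ x′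
    expanded h = trans (inner-combinationʳ x₀ (vector y′) (- y₀) (vector x′) (vector h))
      (+-cong (*-congˡ (inner-vector h y′)) (*-congˡ (inner-vector h x′)))

  vector-zero : ∀ {n} {x : Vector Carrier n} → x ≋ 𝟎 → vector x ≋ 𝟎
  vector-zero x≋0 I = sum-zero λ i → trans (*-congʳ (x≋0 i)) (zeroˡ _)

  ∣I∣≡0⇒⊥≡I : ∀ {n} {I : Subset n} → ∣ I ∣ ≡ 0 → ⊥ ≡ I
  ∣I∣≡0⇒⊥≡I {I = []}          _  = ≡.refl
  ∣I∣≡0⇒⊥≡I {I = outside ∷ I} eq = ≡.cong (outside ∷_) (∣I∣≡0⇒⊥≡I eq)

  e-vector : ∀ {n} (I : Subset n) → ∣ I ∣ ≡ 1 → ∃ λ x → vector x ≋ e I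
  e-vector (outside ∷ I) eq with e-vector I eq
  ... | x , x≋e = 0# ∷ᵥ x , λ where
    (outside ∷ J) → trans (vector-outside (0# ∷ᵥ x) J) (x≋e J)
    (inside  ∷ J) → trans (vector-inside (0# ∷ᵥ x) J) (zeroˡ _)
  e-vector (inside  ∷ I) eq with ≡.refl ← ∣I∣≡0⇒⊥≡I {I = I} (ℕ.suc-injective eq) = 1# ∷ᵥ 𝟎 , λ where
    (outside ∷ J) → trans (vector-outside (1# ∷ᵥ 𝟎) J) (vector-zero (λ _ → refl) J)
    (inside  ∷ J) → trans (vector-inside (1# ∷ᵥ 𝟎) J) (*-identityˡ _)

  e-∧ᵥ : ∀ {n} (I : Subset n) → ∣ I ∣ ≡ 2 → ∃₂ λ x y → x ∧ᵥ y ≋ e I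
  e-∧ᵥ (outside ∷ I) eq with e-∧ᵥ I eq
  ... | x , y , xy≋e = 0# ∷ᵥ x , 0# ∷ᵥ y , λ where
    (outside ∷ J) → trans (∧ᵥ-outside (0# ∷ᵥ x) (0# ∷ᵥ y) J) (xy≋e J)
    (inside  ∷ J) → trans (∧ᵥ-inside (0# ∷ᵥ x) (0# ∷ᵥ y) J)
      (trans (+-cong (zeroˡ _) (trans (*-congʳ -0#≈0#) (zeroˡ _))) (+-identityʳ 0#))
  e-∧ᵥ (inside  ∷ I) eq with e-vector I (ℕ.suc-injective eq)
  ... | y , y≋e = 1# ∷ᵥ 𝟎 , 0# ∷ᵥ y , λ where
    (outside ∷ J) → trans (∧ᵥ-outside (1# ∷ᵥ 𝟎) (0# ∷ᵥ y) J) (∧-zeroˡ (vector y) (vector-zero λ _ → refl) J)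
    (inside  ∷ J) → trans (∧ᵥ-inside (1# ∷ᵥ 𝟎) (0# ∷ᵥ y) J)
      (trans (+-cong (trans (*-identityˡ _) (y≋e J)) (trans (*-congʳ -0#≈0#) (zeroˡ _))) (+-identityʳ _))

  -- The Hodge dual and the pairing with bivectors.

  sign : ∀ {n} → Subset n → Carrier
  sign J = (e (∁ J) ∧ e J) ⊤ˢ

  [-1]^k*[-1]^k≈1 : ∀ k → (- 1#) ^ k * (- 1#) ^ k ≈ 1#
  [-1]^k*[-1]^k≈1 zero    = *-identityʳ 1#
  [-1]^k*[-1]^k≈1 (suc k) = trans (solve 2 (λ a b → :- a :* b :* (:- a :* b) := a :* a :* (b :* b)) refl 1# ((- 1#) ^ k))
    (trans (*-cong (*-identityʳ 1#) ([-1]^k*[-1]^k≈1 k)) (*-identityʳ 1#))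

  -- For `outside ∷ J` the vector e₀ already stands in front. For `inside ∷ J` it has to pass e_{∁
  -- J}, which multiplies the sign by the power `ε` of -1.
  sign*sign≈1 : ∀ {n} (J : Subset n) → sign J * sign J ≈ 1#
  sign*sign≈1 []            = trans (*-cong (*-identityʳ 1#) (*-identityʳ 1#)) (*-identityʳ 1#)
  sign*sign≈1 {suc n} (outside ∷ J) = trans (*-cong eq eq) (sign*sign≈1 J)
    where
    eq : sign (outside ∷ J) ≈ sign J
    eq = trans (+-congˡ (∧-zeroʳ {n} (involute 𝟎) {𝟎} (λ _ → refl) ⊤ˢ)) (+-identityʳ _)
  sign*sign≈1 {suc n} (inside  ∷ J) = begin
    sign (inside ∷ J) * sign (inside ∷ J)         ≈⟨ *-cong eq eq ⟩
    ε * sign J * (ε * sign J)                     ≈⟨ solve 2 (λ ε s → ε :* s :* (ε :* s) := ε :* ε :* (s :* s)) refl ε (sign J) ⟩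
    ε * ε * (sign J * sign J)                     ≈⟨ *-cong ([-1]^k*[-1]^k≈1 ∣ ∁ J ∣) (sign*sign≈1 J) ⟩
    1# * 1#                                       ≈⟨ *-identityʳ 1# ⟩
    1#                                            ∎
    where
    ε = (- 1#) ^ ∣ ∁ J ∣
    eq : sign (inside ∷ J) ≈ ε * sign J
    eq = begin
      (𝟎 {Subset n} ∧ 𝟎) ⊤ˢ + (involute (e (∁ J)) ∧ e J) ⊤ˢ
        ≈⟨ +-cong (∧-zeroˡ {n} {𝟎} 𝟎 (λ _ → refl) ⊤ˢ) (∧-cong (involute-e (∁ J)) (λ _ → refl) ⊤ˢ) ⟩
      0# + ((λ I → ε * e (∁ J) I) ∧ e J) ⊤ˢ
        ≈⟨ +-identityˡ _ ⟩
      ((λ I → ε * e (∁ J) I) ∧ e J) ⊤ˢ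
        ≈⟨ ∧-scaleˡ ε (e (∁ J)) (e J) ⊤ˢ ⟩
      ε * sign J ∎

  -- Consequently ⟨ ⋆ a , x ∧ y ⟩ is the inner product of a with x ∧ y, so a motion may be specified
  -- by a bivector and evaluated by `cauchy-binet`.
  inner-⋆ : ∀ {n} (a b : Λ n) → inner (⋆ a) (⋆ b) ≈ inner a b
  inner-⋆ a b = trans
    (sumOverSubsets-cong λ J → trans
      (solve 3 (λ s a b → s :* a :* (s :* b) := s :* s :* (a :* b)) refl (sign J) (a (∁ J)) (b (∁ J)))
      (trans (*-congʳ (sign*sign≈1 J)) (*-identityˡ _)))
    (sumOverSubsets-∁ (λ I → a I * b I))

  ∁-injective : ∀ {n} {I J : Subset n} → ∁ I ≡ ∁ J → I ≡ J
  ∁-injective {I = []}    {[]}    _  = ≡.refl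
  ∁-injective {I = i ∷ I} {j ∷ J} eq =
    ≡.cong₂ _∷_ (Bool.not-injective (Vec.∷-injectiveˡ eq)) (∁-injective (Vec.∷-injectiveʳ eq))

  ⟨⟩-form : ∀ {n} → Λ n → LinearForm (Subset n)
  ⟨⟩-form b = inner-form (⋆ b)

  ⟨⟩-congʳ : ∀ {n} (a : Λ n) {b b′ : Λ n} → b ≋ b′ → ⟨ a , b ⟩ ≈ ⟨ a , b′ ⟩
  ⟨⟩-congʳ a b≋b′ = sumOverSubsets-cong λ J → *-congˡ (*-congˡ (b≋b′ (∁ J)))

  ⟨⟩-linearʳ : ∀ {n} (a b : Λ n) s b′ → ⟨ a , (λ I → b I + s * b′ I) ⟩ ≈ ⟨ a , b ⟩ + s * ⟨ a , b′ ⟩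
  ⟨⟩-linearʳ a b s b′ = trans
    (sumOverSubsets-cong λ J → solve 5 (λ a σ b s b′ → a :* (σ :* (b :+ s :* b′)) := a :* (σ :* b) :+ s :* (a :* (σ :* b′)))
      refl (a J) (sign J) (b (∁ J)) s (b′ (∁ J)))
    (sumOverSubsets-linear (λ J → a J * (⋆ b) J) s _)

  ⟨⟩-∧ᵥ-form : ∀ {n} → Λ n → Vector Carrier n → LinearForm (Fin n)
  ⟨⟩-∧ᵥ-form a x = record
    { _·_    = λ y → ⟨ a , x ∧ᵥ y ⟩
    ; ·-cong = λ y≋z → ⟨⟩-congʳ a (∧-cong (λ _ → refl) λ I → sum-cong-≋ λ i → *-congʳ (y≋z i))
    ; linear = λ y s z → trans (⟨⟩-congʳ a (∧ᵥ-linear x y s z)) (⟨⟩-linearʳ a (x ∧ᵥ y) s (x ∧ᵥ z))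
    }

  ⟨⟩-antisym : ∀ {n} (a : Λ n) x y → ⟨ a , x ∧ᵥ y ⟩ ≈ - ⟨ a , y ∧ᵥ x ⟩
  ⟨⟩-antisym a x y = begin
    ⟨ a , x ∧ᵥ y ⟩                               ≈⟨ ⟨⟩-congʳ a (λ I → trans (∧ᵥ-antisym x y I) (sym (trans (+-identityˡ _) (-1*x≈-x _)))) ⟩
    ⟨ a , (λ I → 0# + - 1# * (y ∧ᵥ x) I) ⟩       ≈⟨ ⟨⟩-linearʳ a 𝟎 (- 1#) (y ∧ᵥ x) ⟩
    ⟨ a , 𝟎 ⟩ + - 1# * ⟨ a , y ∧ᵥ x ⟩            ≈⟨ +-cong (sumOverSubsets-zero {f = λ J → a J * (⋆ 𝟎) J} λ J →
      trans (*-congˡ (zeroʳ (sign J))) (zeroʳ (a J))) (-1*x≈-x _) ⟩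
    0# - ⟨ a , y ∧ᵥ x ⟩                          ≈⟨ +-identityˡ _ ⟩
    - ⟨ a , y ∧ᵥ x ⟩                             ∎

  ∧ᵥ-self : ∀ {n} (x : Vector Carrier n) → x ∧ᵥ x ≋ 𝟎
  ∧ᵥ-self x []            = zeroˡ _
  ∧ᵥ-self x (outside ∷ I) = trans (∧ᵥ-outside x x I) (∧ᵥ-self (x ∘ suc) I)
  ∧ᵥ-self x (inside  ∷ I) = trans (∧ᵥ-inside x x I) (trans (+-congˡ (sym (-‿distribˡ-* _ _))) (-‿inverseʳ _))

  ⟨⟩-self : ∀ {n} (a : Λ n) x → ⟨ a , x ∧ᵥ x ⟩ ≈ 0#
  ⟨⟩-self a x = sumOverSubsets-zero {f = λ J → a J * (⋆ (x ∧ᵥ x)) J} λ J →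
    trans (*-congˡ (trans (*-congˡ (∧ᵥ-self x (∁ J))) (zeroʳ (sign J)))) (zeroʳ (a J))

  -- Up to sign, the coordinate of `a` at J is its pairing with e_{∁ J}; if ∁ J has two elements,
  -- that basis element is decomposable.
  ⟨⟩-nondegenerate : ∀ {n} (a : Λ n) → (∀ J → ∣ ∁ J ∣ ≢ 2 → a J ≈ 0#) → (∀ x y → ⟨ a , x ∧ᵥ y ⟩ ≈ 0#) → a ≋ 𝟎
  ⟨⟩-nondegenerate a grade vanishes J with ∣ ∁ J ∣ ℕ.≟ 2
  ... | no  ∣∁J∣≢2 = grade J ∣∁J∣≢2
  ... | yes ∣∁J∣≡2 with e-∧ᵥ (∁ J) ∣∁J∣≡2
  ... | x , y , xy≋e = begin
    a J                            ≈⟨ *-identityʳ _ ⟨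
    a J * 1#                       ≈⟨ *-congˡ (sign*sign≈1 J) ⟨
    a J * (sign J * sign J)        ≈⟨ *-assoc _ _ _ ⟨
    a J * sign J * sign J          ≈⟨ *-congʳ (begin
      a J * sign J                   ≈⟨ *-congˡ (trans (*-congˡ (e-refl (∁ J))) (*-identityʳ _)) ⟨
      a J * (sign J * e (∁ J) (∁ J)) ≈⟨ sumOverSubsets-single {f = λ I → a I * (⋆ e (∁ J)) I} J (λ I I≢J → trans (*-congˡ (trans
                                          (*-congˡ (e-≢ (I≢J ∘ ≡.sym ∘ ∁-injective))) (zeroʳ _))) (zeroʳ _)) ⟨
      ⟨ a , e (∁ J) ⟩                ≈⟨ ⟨⟩-congʳ a xy≋e ⟨
      ⟨ a , x ∧ᵥ y ⟩                 ≈⟨ vanishes x y ⟩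
      0#                             ∎) ⟩
    0# * sign J                    ≈⟨ zeroˡ _ ⟩
    0#                             ∎

  -- Homogeneous coordinates and affine spans.

  at-last-or-punchIn : ∀ {p d} (Q : Fin (suc d) → Set p) → Q (fromℕ d) → (∀ t → Q (punchIn (fromℕ d) t)) → ∀ a → Q a
  at-last-or-punchIn {d = d} Q last init a with fromℕ d Fin.≟ a
  ... | yes ≡.refl = last
  ... | no  d≢a    = ≡.subst Q (Fin.punchIn-punchOut d≢a) (init _)

  homogenize-last : ∀ {d} (x : Point d) → homogenize x (fromℕ d) ≈ 1#
  homogenize-last {d} x = reflexive (VecF.insertAt-lookup x (fromℕ d) 1#)

  homogenize-punchIn : ∀ {d} (x : Point d) t → homogenize x (punchIn (fromℕ d) t) ≈ x t
  homogenize-punchIn {d} x t = reflexive (VecF.insertAt-punchIn x (fromℕ d) 1# t)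

  homogenize-cong : ∀ {d} {x y : Point d} → x ≋ y → homogenize x ≋ homogenize y
  homogenize-cong {d} {x} {y} x≋y = at-last-or-punchIn (λ a → homogenize x a ≈ homogenize y a)
    (trans (homogenize-last x) (sym (homogenize-last y)))
    (λ t → trans (homogenize-punchIn x t) (trans (x≋y t) (sym (homogenize-punchIn y t))))

  combination-homogenize-last : ∀ {d k} (s : Fin k → Carrier) (q : Fin k → Point d) →
    combination s (homogenize ∘ q) (fromℕ d) ≈ sum s
  combination-homogenize-last s q = sum-cong-≋ λ j → trans (*-congˡ (homogenize-last (q j))) (*-identityʳ _)

  combination-homogenize-punchIn : ∀ {d k} (s : Fin k → Carrier) (q : Fin k → Point d) t →
    combination s (homogenize ∘ q) (punchIn (fromℕ d) t) ≈ sum λ j → s j * q j t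
  combination-homogenize-punchIn s q t = sum-cong-≋ λ j → *-congˡ (homogenize-punchIn (q j) t)

  -- The vectors (q , 1) span: if y has last coordinate λ and initial part y′, then y = (y′ , 1) +
  -- (λ - 1) (0 , 1).
  vanishes-on-homogenize : ∀ {d} (φ : LinearForm (Fin (suc d))) → (∀ q → φ · homogenize q ≈ 0#) → ∀ y → φ · y ≈ 0#
  vanishes-on-homogenize {d} φ φ≈0 y = begin
    φ · y
      ≈⟨ ·-cong φ (at-last-or-punchIn (λ a → y a ≈ homogenize y′ a + (y (fromℕ d) - 1#) * homogenize 𝟎 a)
           (sym (trans (+-cong (homogenize-last y′) (trans (*-congˡ (homogenize-last {d} 𝟎)) (*-identityʳ _)))
             (solve 2 (λ o z → o :+ (z :- o) := z) refl 1# (y (fromℕ d)))))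
           (λ t → sym (trans (+-cong (homogenize-punchIn y′ t) (trans (*-congˡ (homogenize-punchIn 𝟎 t)) (zeroʳ _))) (+-identityʳ _)))) ⟩
    φ · (λ a → homogenize y′ a + (y (fromℕ d) - 1#) * homogenize 𝟎 a)
      ≈⟨ linear φ _ _ _ ⟩
    φ · homogenize y′ + (y (fromℕ d) - 1#) * φ · homogenize 𝟎
      ≈⟨ +-cong (φ≈0 y′) (trans (*-congˡ (φ≈0 𝟎)) (zeroʳ _)) ⟩
    0# + 0#
      ≈⟨ +-identityʳ 0# ⟩
    0# ∎
    where
    y′ : Point d
    y′ = y ∘ punchIn (fromℕ d)

  ⟨⟩-vanishes-on-homogenize : ∀ {d} (a : Λ (suc d)) x → (∀ (q : Point d) → ⟨ a , x ∧ᵥ homogenize q ⟩ ≈ 0#) →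
    ∀ y → ⟨ a , x ∧ᵥ y ⟩ ≈ 0#
  ⟨⟩-vanishes-on-homogenize a x = vanishes-on-homogenize (⟨⟩-∧ᵥ-form a x)

  ∙-affineSpan : ∀ {d p} {S : Pred (Point d) p} (f : Vector Carrier (suc d)) → (∀ x → S x → f ∙ homogenize x ≈ 0#) →
                 ∀ x → AffineSpan S x → f ∙ homogenize x ≈ 0#
  ∙-affineSpan {d} f f≈0 x (k , q , s , Sq , Σs≈1 , Σsq≋x) = begin
    f ∙ homogenize x
      ≈⟨ ∙-comm f (homogenize x) ⟩
    homogenize x ∙ f
      ≈⟨ ·-cong (∙-form f) (at-last-or-punchIn (λ a → homogenize x a ≈ combination s (homogenize ∘ q) a)
           (trans (homogenize-last x) (sym (trans (combination-homogenize-last s q) Σs≈1)))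
           (λ t → trans (homogenize-punchIn x t) (sym (trans (combination-homogenize-punchIn s q t) (Σsq≋x t))))) ⟩
    combination s (homogenize ∘ q) ∙ f
      ≈⟨ ·-combination (∙-form f) s (homogenize ∘ q) ⟩
    sum (λ j → s j * homogenize (q j) ∙ f)
      ≈⟨ sum-zero (λ j → trans (*-congˡ (trans (∙-comm (homogenize (q j)) f) (f≈0 (q j) (Sq j)))) (zeroʳ _)) ⟩
    0# ∎

  ⊆-affineSpan : ∀ {d p} {S : Pred (Point d) p} {x} → S x → AffineSpan S x
  ⊆-affineSpan {x = x} Sx =
    1 , (λ _ → x) , (λ _ → 1#) , (λ _ → Sx) , +-identityʳ 1# , λ t → trans (+-identityʳ _) (*-identityˡ _)

  -- The vectors z (σ l) lie in the radical, so expanding both arguments in the adapted basis leaves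
  -- only values on pairs of y's. This bounds the space of pinned forms from above.
  form-vanishes : ∀ {I : Set} {n} {z : I → Vector Carrier n} {rs} (B : AdaptedBasis z rs) (a : Λ n) →
    (let open AdaptedBasis B) →
    (∀ i j → ⟨ a , y i ∧ᵥ y j ⟩ ≈ 0#) → (∀ l w → ⟨ a , z (σ l) ∧ᵥ w ⟩ ≈ 0#) → ∀ x w → ⟨ a , x ∧ᵥ w ⟩ ≈ 0#
  form-vanishes {z = z} B a yy≈0 z≈0 x w = begin
    ⟨ a , x ∧ᵥ w ⟩
      ≈⟨ ·-decompose B (⟨⟩-∧ᵥ-form a x) w (λ l → z≈0ʳ l x) ⟩
    sum (λ i → f i ∙ w * ⟨ a , x ∧ᵥ y i ⟩)
      ≈⟨ sum-zero (λ i → trans (*-congˡ (trans (⟨⟩-antisym a x (y i)) (trans (-‿cong (y≈0 i)) -0#≈0#))) (zeroʳ _)) ⟩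
    0# ∎
    where
    open AdaptedBasis B
    z≈0ʳ : ∀ l x → ⟨ a , x ∧ᵥ z (σ l) ⟩ ≈ 0#
    z≈0ʳ l x = trans (⟨⟩-antisym a x _) (trans (-‿cong (z≈0 l x)) -0#≈0#)
    y≈0 : ∀ i → ⟨ a , y i ∧ᵥ x ⟩ ≈ 0#
    y≈0 i = trans (·-decompose B (⟨⟩-∧ᵥ-form a (y i)) x (λ l → z≈0ʳ l (y i)))
      (sum-zero λ j → trans (*-congˡ (yy≈0 i j)) (zeroʳ _))

  standardBasis : ∀ n → AdaptedBasis {Empty} {n} (λ ()) []
  standardBasis n = adaptedBasis (λ ()) []

  ∣∁∣≡2 : ∀ {d} (I : Subset (suc d)) → .{{_ : NonZero d}} → ∣ I ∣ ≡ d ∸ 1 → ∣ ∁ I ∣ ≡ 2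
  ∣∁∣≡2 {suc d} I eq = ≡.trans (∣∁p∣≡n∸∣p∣ I) (≡.trans (≡.cong (suc (suc d) ∸_) eq) (ℕ.m+n∸n≡m 2 d))

  ∣∁∣≡2⁻ : ∀ {d} (I : Subset (suc d)) → ∣ ∁ I ∣ ≡ 2 → ∣ I ∣ ≡ d ∸ 1
  ∣∁∣≡2⁻ {d} I eq = ≡.trans (≡.sym (ℕ.m∸[m∸n]≡n (∣p∣≤n I)))
    (≡.cong (suc d ∸_) (≡.trans (≡.sym (∣∁p∣≡n∸∣p∣ I)) eq))

  -- Freedom and pin rank of a single part.

  triangle-adapted : ∀ {I : Set} {d} {z : I → Vector Carrier (suc d)} {rs} (B : AdaptedBasis z rs) →
    triangle (suc d) ≡ triangle (AdaptedBasis.t B) ℕ.+ ℕSum.sum {AdaptedBasis.s B} (λ i → d ∸ toℕ i)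
  triangle-adapted B = ≡.subst (λ n → triangle n ≡ triangle t ℕ.+ ℕSum.sum {s} (λ i → n ∸ suc (toℕ i))) s+t≡n (triangle-+ s t)
    where open AdaptedBasis B

  module _ {n d ρ} (R : Fin ρ → Fin n) (p° : Fin ρ → Point d) (X : Subset n) where

    -- What necessity extracts from `HasDimension`: linear forms vanishing at the pins of X, with
    -- the vectors `y` witnessing their independence. Only a lower bound on the freedom is recorded:
    -- at most k + 1 points are selected, and each selected point accounts for one term of
    -- `pinRank d k`.
    record Annihilator (k : ℕ) : Set (c ⊔ ℓ₁) where
      field
        t     : ℕ
        f y   : Fin t → Vector Carrier (suc d)
        f∙y-≡ : ∀ i → f i ∙ y i ≈ 1#
        f∙y-≢ : ∀ {i j} → i ≢ j → f i ∙ y j ≈ 0#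
        f∙p   : ∀ i r → R r ∈ X → f i ∙ homogenize (p° r) ≈ 0#
        large : triangle (suc d) ℕ.≤ triangle t ℕ.+ (if does (R_X≢∅? R X) then pinRank d k else 0)

    annihilator : ∀ k → (R_X≢∅ R X → HasDimension (AffineSpan (Image R p° X)) k) → Annihilator k
    annihilator k dimension with R_X≢∅? R X
    ... | no empty = record
      { AdaptedBasis (standardBasis (suc d))
      ; f∙p   = λ i r r∈X → contradiction (r , r∈X) empty
      ; large = ℕ.m≤m+n _ _
      }
    ... | yes nonempty with dimension nonempty
    ... | q , _ , _ , spans = record
      { AdaptedBasis B
      ; f∙p   = λ i r r∈X → ∙-affineSpan {S = Range q} (f i)
          (λ x (j , qj≋x) → trans (∙-congʳ (f i) (homogenize-cong λ t → sym (qj≋x t))) (f∙z i (∈-allFin j)))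
          (p° r) (spans _ (⊆-affineSpan {S = Image R p° X} (r , r∈X , λ _ → refl)))
      ; large = ℕ.≤-trans (ℕ.≤-reflexive (triangle-adapted B))
          (ℕ.+-monoʳ-≤ (triangle t) (ℕ.≤-trans
            (sum-extend-≤ (d ∸_) (≡.subst (s ℕ.≤_) (List.length-tabulate {n = suc k} (λ i → i)) s≤∣rs∣))
            (ℕ.≤-reflexive (≡.cong (λ b → if b then pinRank d k else 0) (≡.sym (dec-true (R_X≢∅? R X) nonempty))))))
      }
      where
      B = adaptedBasis (homogenize ∘ q) (allFin (suc k))
      open AdaptedBasis B

    pinned : List (Fin ρ)
    pinned = filter (λ r → R r ∈? X) (allFin ρ)

    pinnedBasis : AdaptedBasis (homogenize ∘ p°) pinned
    pinnedBasis = adaptedBasis (homogenize ∘ p°) pinned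

    private module B = AdaptedBasis pinnedBasis

    σ∈X : ∀ l → R (B.σ l) ∈ X
    σ∈X l = proj₂ (∈-filter⁻ (λ r → R r ∈? X) {xs = allFin ρ} (B.σ∈rs l))

    -- Independent homogenized points number one more than the dimension of their affine span.
    -- Without pins the value is 0 by default, but the counting condition reads it only for parts
    -- with pins.
    pinnedDimension : ℕ
    pinnedDimension = ℕ.pred B.s

    -- With s = 0 a homogenized pin would expand to zero, whereas its last coordinate is 1.
    s≢0 : R_X≢∅ R X → B.s ≢ 0
    s≢0 (r , r∈X) s≡0 = 1≉0 (begin
      1#
        ≈⟨ homogenize-last (p° r) ⟨
      homogenize (p° r) (fromℕ d)
        ≈⟨ B.decompose (homogenize (p° r)) (fromℕ d) ⟩
      combination (λ i → B.f i ∙ homogenize (p° r)) B.y (fromℕ d)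
        + combination (λ l → B.g l ∙ homogenize (p° r)) (homogenize ∘ p° ∘ B.σ) (fromℕ d)
        ≈⟨ +-cong (sum-zero λ i → trans (*-congʳ (B.f∙z i (∈-filter⁺ (λ r → R r ∈? X) (∈-allFin r) r∈X))) (zeroˡ _))
                  (sum-zero λ l → contradiction (≡.subst Fin s≡0 l) λ ()) ⟩
      0# + 0#
        ≈⟨ +-identityʳ 0# ⟩
      0# ∎)

    -- The selected pins form an affine basis. The dual forms g give independence; the forms f kill
    -- the whole affine span, so a point of it expands in the selected pins alone, and the last
    -- coordinate says that the coefficients sum to 1.
    pinned-hasDimension : R_X≢∅ R X → HasDimension (AffineSpan (Image R p° X)) pinnedDimension
    pinned-hasDimension nonempty with B.s | s≢0 nonempty | B.σ | σ∈X | B.g | B.g∙z-≡ | B.g∙z-≢ | B.decompose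
    ... | zero  | 0≢0 | _ | _ | _ | _ | _ | _ = contradiction ≡.refl 0≢0
    ... | suc k | _   | σ | σ∈ | g | g∙z-≡ | g∙z-≢ | decompose =
      p° ∘ σ
      , (λ l → ⊆-affineSpan {S = Image R p° X} (σ l , σ∈ l , λ _ → refl))
      , (λ s Σs≈0 Σsq≈0 l → begin
          s l
            ≈⟨ *-identityʳ _ ⟨
          s l * 1#
            ≈⟨ *-congˡ (trans (∙-comm (homogenize (p° (σ l))) (g l)) (g∙z-≡ l)) ⟨
          s l * homogenize (p° (σ l)) ∙ g l
            ≈⟨ sum-single {t = λ m → s m * homogenize (p° (σ m)) ∙ g l} l
                 (λ m m≢l → trans (*-congˡ (trans (∙-comm (homogenize (p° (σ m))) (g l)) (g∙z-≢ (m≢l ∘ ≡.sym)))) (zeroʳ _)) ⟨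
          sum (λ m → s m * homogenize (p° (σ m)) ∙ g l)
            ≈⟨ ·-combination (∙-form (g l)) s (homogenize ∘ p° ∘ σ) ⟨
          combination s (homogenize ∘ p° ∘ σ) ∙ g l
            ≈⟨ ∙-form-zero _ (g l) (at-last-or-punchIn (λ a → combination s (homogenize ∘ p° ∘ σ) a ≈ 0#)
                 (trans (combination-homogenize-last s (p° ∘ σ)) Σs≈0)
                 (λ t → trans (combination-homogenize-punchIn s (p° ∘ σ) t) (Σsq≈0 t))) ⟩
          0# ∎)
      , (λ x x∈ → let
            s = λ l → g l ∙ homogenize x
            x≋ : homogenize x ≋ combination s (homogenize ∘ p° ∘ σ)
            x≋ a = trans (decompose (homogenize x) a) (trans (+-congʳ (sum-zero λ i →
              trans (*-congʳ (∙-affineSpan {S = Image R p° X} (B.f i) (λ w (r , r∈X , pr≋w) →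
                  trans (∙-congʳ (B.f i) (homogenize-cong λ t → sym (pr≋w t)))
                        (B.f∙z i (∈-filter⁺ (λ r → R r ∈? X) (∈-allFin r) r∈X))) x x∈)) (zeroˡ _)))
              (+-identityˡ _))
          in suc k , p° ∘ σ , s , (λ l → l , λ _ → refl)
           , trans (sym (combination-homogenize-last s (p° ∘ σ))) (trans (sym (x≋ (fromℕ d))) (homogenize-last x))
           , λ t → trans (sym (combination-homogenize-punchIn s (p° ∘ σ) t)) (trans (sym (x≋ _)) (homogenize-punchIn x t)))

    pinned-rank : triangle (suc d) ≡ triangle B.t ℕ.+ (if does (R_X≢∅? R X) then pinRank d pinnedDimension else 0)
    pinned-rank = ≡.trans (triangle-adapted pinnedBasis) (≡.cong (triangle B.t ℕ.+_) rank)
      where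
      rank : ℕSum.sum {B.s} (λ i → d ∸ toℕ i) ≡ (if does (R_X≢∅? R X) then pinRank d pinnedDimension else 0)
      rank with R_X≢∅? R X | B.s | s≢0 | B.σ | σ∈X
      ... | no  _        | zero  | _   | _ | _ = ≡.refl
      ... | no  empty    | suc _ | _   | σ | σ∈ = contradiction (σ zero , σ∈ zero) empty
      ... | yes nonempty | zero  | ≢0  | _ | _ = contradiction ≡.refl (≢0 nonempty)
      ... | yes _        | suc _ | _   | _ | _ = ≡.refl

  -- Necessity: rigidity implies the counting inequality.

  module Necessity {d : ℕ} .{{_ : NonZero d}} (G : Graph) {ρ : ℕ} (R : Fin ρ → Graph.V G) (p° : Fin ρ → Point d)
    (𝒫 : Partition (Graph.#V G)) (k : Fin (Partition.size 𝒫) → ℕ)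
    (dimension : ∀ X → R_X≢∅ R (Partition.part 𝒫 X) → HasDimension (AffineSpan (Image R p° (Partition.part 𝒫 X))) (k X))
    where
    open Graph G
    open Partition 𝒫

    private module A X = Annihilator (annihilator R p° (part X) (k X) (dimension X))

    Unknown : Set
    Unknown = Σ (Fin size) (Pair ∘ A.t)

    form : ∀ X → Pair (A.t X) → Λ (suc d)
    form X (j , i) = A.f X (inject i) ∧ᵥ A.f X j

    inject≢ : ∀ {n} (j : Fin n) (i : Fin (toℕ j)) → inject i ≢ j
    inject≢ j i eq = ℕ.<⇒≢ (Fin.toℕ<n i) (≡.trans (≡.sym (Fin.toℕ-inject i)) (≡.cong toℕ eq))

    form-dual-≡ : ∀ X j (i : Fin (toℕ j)) → inner (form X (j , i)) (A.y X (inject i) ∧ᵥ A.y X j) ≈ 1#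
    form-dual-≡ X j i = begin
      inner (form X (j , i)) (A.y X (inject i) ∧ᵥ A.y X j)
        ≈⟨ cauchy-binet (A.f X (inject i)) (A.f X j) (A.y X (inject i)) (A.y X j) ⟩
      A.f X (inject i) ∙ A.y X (inject i) * A.f X j ∙ A.y X j - A.f X (inject i) ∙ A.y X j * A.f X j ∙ A.y X (inject i)
        ≈⟨ +-cong (*-cong (A.f∙y-≡ X _) (A.f∙y-≡ X j)) (-‿cong (trans (*-congʳ (A.f∙y-≢ X (inject≢ j i))) (zeroˡ _))) ⟩
      1# * 1# - 0#
        ≈⟨ trans (+-cong (*-identityʳ 1#) -0#≈0#) (+-identityʳ 1#) ⟩
      1# ∎

    form-dual-≢ : ∀ X j (i : Fin (toℕ j)) j₀ (i₀ : Fin (toℕ j₀)) → (j , i) ≢ (j₀ , i₀) →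
                  inner (form X (j , i)) (A.y X (inject i₀) ∧ᵥ A.y X j₀) ≈ 0#
    form-dual-≢ X j i j₀ i₀ ji≢ = begin
      inner (form X (j , i)) (A.y X (inject i₀) ∧ᵥ A.y X j₀)
        ≈⟨ cauchy-binet (A.f X (inject i)) (A.f X j) (A.y X (inject i₀)) (A.y X j₀) ⟩
      A.f X (inject i) ∙ A.y X (inject i₀) * A.f X j ∙ A.y X j₀ - A.f X (inject i) ∙ A.y X j₀ * A.f X j ∙ A.y X (inject i₀)
        ≈⟨ +-cong straight (-‿cong crossed) ⟩
      0# - 0#
        ≈⟨ -‿inverseʳ 0# ⟩
      0# ∎
      where
      straight : A.f X (inject i) ∙ A.y X (inject i₀) * A.f X j ∙ A.y X j₀ ≈ 0#
      straight with j Fin.≟ j₀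
      ... | no  j≢j₀   = trans (*-congˡ (A.f∙y-≢ X j≢j₀)) (zeroʳ _)
      ... | yes ≡.refl = trans (*-congʳ (A.f∙y-≢ X λ eq → ji≢ (≡.cong (j ,_) (Fin.toℕ-injective
                           (≡.trans (≡.sym (Fin.toℕ-inject i)) (≡.trans (≡.cong toℕ eq) (Fin.toℕ-inject i₀))))))) (zeroˡ _)
      -- Both factors can be nonzero only if i = j₀ and j = i₀, which is incompatible with i < j and
      -- i₀ < j₀.
      crossed : A.f X (inject i) ∙ A.y X j₀ * A.f X j ∙ A.y X (inject i₀) ≈ 0#
      crossed with j Fin.≟ inject i₀
      ... | no  j≢i₀ = trans (*-congˡ (A.f∙y-≢ X j≢i₀)) (zeroʳ _)
      ... | yes j≡i₀ = trans (*-congʳ (A.f∙y-≢ X λ i≡j₀ → ℕ.<-asym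
              (≡.subst (ℕ._< toℕ j) (≡.trans (≡.sym (Fin.toℕ-inject i)) (≡.cong toℕ i≡j₀)) (Fin.toℕ<n i))
              (≡.subst (ℕ._< toℕ j₀) (≡.trans (≡.sym (Fin.toℕ-inject i₀)) (≡.sym (≡.cong toℕ j≡i₀))) (Fin.toℕ<n i₀)))) (zeroˡ _)

    module Enum X = Inverse (Pair-enumerate (A.t X))

    bivectorAt : (Unknown → Carrier) → Fin size → Λ (suc d)
    bivectorAt z X = combination (λ l → z (X , Enum.from X l)) (form X ∘ Enum.from X)

    inner-bivectorAt : ∀ z X b → inner (bivectorAt z X) b ≈ sum λ l → z (X , Enum.from X l) * inner (form X (Enum.from X l)) b
    inner-bivectorAt z X b = ·-combination (inner-form b) (λ l → z (X , Enum.from X l)) (form X ∘ Enum.from X)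

    bivectorAt-grade : ∀ z X I → ∣ I ∣ ≢ 2 → bivectorAt z X I ≈ 0#
    bivectorAt-grade z X I ∣I∣≢2 = sum-zero {t = λ l → z (X , Enum.from X l) * form X (Enum.from X l) I} λ l →
      let (j , i) = Enum.from X l in trans (*-congˡ (∧ᵥ-grade (A.f X (inject i)) (A.f X j) I ∣I∣≢2)) (zeroʳ _)

    -- The value depends only on the part containing v, and the dual makes it act on bivectors as
    -- the chosen combination of the f_i ∧ f_j.
    motion : (Unknown → Carrier) → V → ⋀ (d ∸ 1) (suc d)
    motion z v = record
      { element     = ⋆ bivectorAt z (partOf v)
      ; homogeneous = λ I ∣I∣≢ →
          trans (*-congˡ (bivectorAt-grade z (partOf v) (∁ I) (∣I∣≢ ∘ ∣∁∣≡2⁻ I))) (zeroʳ (sign I))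
      }

    crossing : List E
    crossing = filter (λ i → ¬? (partOf (end₁ i) Fin.≟ partOf (end₂ i))) (allFin #E)

    module _ (b : E → Setoid.Carrier (Gr₂ (suc d))) where

      relative : Fin (length crossing) → LinearForm Unknown
      relative l = pullback (⟨⟩-form (bivector (b i)))
        (λ z → element (motion z (end₁ i)) ⊖ element (motion z (end₂ i)))
        (λ z≋w I → +-cong (*-congˡ (bivectorAt-cong z≋w (partOf (end₁ i)) (∁ I)))
                          (-‿cong (*-congˡ (bivectorAt-cong z≋w (partOf (end₂ i)) (∁ I)))))
        (λ z s w I → trans
          (+-cong (*-congˡ (bivectorAt-linear z s w (partOf (end₁ i)) (∁ I)))
                  (-‿cong (*-congˡ (bivectorAt-linear z s w (partOf (end₂ i)) (∁ I)))))
          (solve 6 (λ σ a s a′ b b′ → σ :* (a :+ s :* a′) :- σ :* (b :+ s :* b′) := (σ :* a :- σ :* b) :+ s :* (σ :* a′ :- σ :* b′))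
            refl (sign I) _ s _ _ _))
        where
        i = List.lookup crossing l
        bivectorAt-cong : ∀ {z w} → z ≋ w → ∀ X → bivectorAt z X ≋ bivectorAt w X
        bivectorAt-cong z≋w X = combination-cong (form X ∘ Enum.from X) (λ l → z≋w (X , Enum.from X l))
        bivectorAt-linear : ∀ z s w X I → bivectorAt (λ a → z a + s * w a) X I ≈ bivectorAt z X I + s * bivectorAt w X I
        bivectorAt-linear z s w X I =
          combination-linear (λ l → z (X , Enum.from X l)) s (λ l → w (X , Enum.from X l)) (form X ∘ Enum.from X) I

      -- An edge inside a part sees equal values at its ends, and a crossing edge is one of the
      -- imposed equations. Pins hold because each term of `cauchy-binet` contains a factor f ∙ p
      -- that vanishes.
      motion-isInfinitesimal : ∀ z → (∀ l → relative l · z ≈ 0#) → IsInfinitesimalMotion G R b p° (motion z)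
      motion-isInfinitesimal z relative≈0 = edges , pins
        where
        edges : ∀ i → ⟨ element (motion z (end₁ i)) ⊖ element (motion z (end₂ i)) , bivector (b i) ⟩ ≈ 0#
        edges i with partOf (end₁ i) Fin.≟ partOf (end₂ i)
        ... | yes same = ·-zero (⟨⟩-form (bivector (b i))) λ I →
                trans (+-congʳ (reflexive (≡.cong (λ X → (⋆ bivectorAt z X) I) same))) (-‿inverseʳ _)
        ... | no  diff = ≡.subst
                (λ i → ⟨ element (motion z (end₁ i)) ⊖ element (motion z (end₂ i)) , bivector (b i) ⟩ ≈ 0#)
                (≡.sym (Any.lookup-index i∈)) (relative≈0 (Any.index i∈))
          where
          i∈ : i ∈ₗ crossing
          i∈ = ∈-filter⁺ (λ i → ¬? (partOf (end₁ i) Fin.≟ partOf (end₂ i))) (∈-allFin i) diff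
        pins : ∀ v r → R r ≡ v → ∀ q → ⟨ element (motion z v) , homogenize (p° r) ∧ᵥ homogenize q ⟩ ≈ 0#
        pins _ r ≡.refl q = begin
          ⟨ ⋆ bivectorAt z X , p ∧ᵥ homogenize q ⟩
            ≈⟨ inner-⋆ (bivectorAt z X) (p ∧ᵥ homogenize q) ⟩
          inner (bivectorAt z X) (p ∧ᵥ homogenize q)
            ≈⟨ inner-bivectorAt z X (p ∧ᵥ homogenize q) ⟩
          sum (λ l → z (X , Enum.from X l) * inner (form X (Enum.from X l)) (p ∧ᵥ homogenize q))
            ≈⟨ sum-zero (λ l → let (j , i) = Enum.from X l in trans (*-congˡ (begin
                 inner (form X (j , i)) (p ∧ᵥ homogenize q)
                   ≈⟨ cauchy-binet (A.f X (inject i)) (A.f X j) p (homogenize q) ⟩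
                 A.f X (inject i) ∙ p * A.f X j ∙ homogenize q - A.f X (inject i) ∙ homogenize q * A.f X j ∙ p
                   ≈⟨ +-cong (trans (*-congʳ (f∙p≈0 (inject i))) (zeroˡ _)) (-‿cong (trans (*-congˡ (f∙p≈0 j)) (zeroʳ _))) ⟩
                 0# - 0#
                   ≈⟨ -‿inverseʳ 0# ⟩
                 0# ∎)) (zeroʳ _)) ⟩
          0# ∎
          where
          X = partOf (R r)
          p = homogenize (p° r)
          f∙p≈0 : ∀ i → A.f X i ∙ p ≈ 0#
          f∙p≈0 i = A.f∙p X i r (partOf-∈ 𝒫 (R r))

      -- Each part has a vertex, at which its bivector is visible; pairing with the dual y_i ∧ y_j
      -- isolates one coefficient.
      coefficients-zero : ∀ z → (∀ v → IsZero (element (motion z v))) → z ≋ 𝟎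
      coefficients-zero z motion≈0 (X , j , i) with nonempty X
      ... | v , v∈X with ∈⇒partOf≡ 𝒫 v∈X
      ... | ≡.refl = begin
        z (X , j , i)
          ≈⟨ *-identityʳ _ ⟨
        z (X , j , i) * 1#
          ≈⟨ *-cong (reflexive (≡.cong (λ ji → z (X , ji)) from-to)) (trans
               (reflexive (≡.cong (λ ji → inner (form X ji) (yᵢ ∧ᵥ yⱼ)) from-to)) (form-dual-≡ X j i)) ⟨
        z (X , Enum.from X l₀) * inner (form X (Enum.from X l₀)) (yᵢ ∧ᵥ yⱼ)
          ≈⟨ sum-single {t = λ l → z (X , Enum.from X l) * inner (form X (Enum.from X l)) (yᵢ ∧ᵥ yⱼ)} l₀
               (λ l l≢l₀ → trans (*-congˡ (form-dual-≢ X _ _ j i λ eq →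
                 l≢l₀ (≡.trans (≡.sym (Enum.strictlyInverseˡ X l)) (≡.cong (Enum.to X) eq)))) (zeroʳ _)) ⟨
        sum (λ l → z (X , Enum.from X l) * inner (form X (Enum.from X l)) (yᵢ ∧ᵥ yⱼ))
          ≈⟨ inner-bivectorAt z X (yᵢ ∧ᵥ yⱼ) ⟨
        inner (bivectorAt z X) (yᵢ ∧ᵥ yⱼ)
          ≈⟨ inner-⋆ (bivectorAt z X) (yᵢ ∧ᵥ yⱼ) ⟨
        ⟨ ⋆ bivectorAt z X , yᵢ ∧ᵥ yⱼ ⟩
          ≈⟨ ·-zero (⟨⟩-form (yᵢ ∧ᵥ yⱼ)) (motion≈0 v) ⟩
        0# ∎
        where
        yᵢ = A.y X (inject i)
        yⱼ = A.y X j
        l₀ = Enum.to X (j , i)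
        from-to : Enum.from X l₀ ≡ (j , i)
        from-to = Enum.strictlyInverseʳ X (j , i)

      freedom≤∣δ∣ : InfinitesimallyRigid G R b p° → ℕSum.sum (triangle ∘ A.t) ℕ.≤ ∣δ∣ G 𝒫
      freedom≤∣δ∣ rigid = unknowns≤equations (full-Basis (Σ-enumerate λ X → Pair-enumerate (A.t X))) relative
        -- Rigidity is a negated existence statement; decidable equality turns it into the vanishing
        -- of each coordinate.
        λ z _ relative≈0 → coefficients-zero z λ v I → decidable-stable (element (motion z v) I ≟ 0#) λ ≉0 →
          rigid (motion z , motion-isInfinitesimal z relative≈0 , λ motion≈0 → ≉0 (motion≈0 v I))

      rigid⇒count : InfinitesimallyRigid G R b p° →
        ∣δ∣ G 𝒫 ℕ.≥ (suc d Combinatorics.C 2) ℕ.* size ∸ totalPinRank d R 𝒫 k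
      rigid⇒count rigid =
        count-≤ (triangle ∘ A.t) (λ X → if does (R_X≢∅? R (part X)) then pinRank d (k X) else 0)
          (λ X → ℕ.≤-trans (ℕ.≤-reflexive (triangle≡C2 (suc d))) (A.large X)) (freedom≤∣δ∣ rigid)

  -- Sufficiency: choosing bars among the coordinate bivectors.

  module Sufficiency {d′ : ℕ} (G : Graph) {ρ : ℕ} (R : Fin ρ → Graph.V G) (p° : Fin ρ → Point (suc d′))
    (count : ∀ 𝒫 → CountingCondition G R p° 𝒫) where
    open Graph G

    private
      d : ℕ
      d = suc d′

    Coordinate : Set
    Coordinate = V × Subset (suc d)

    Coordinate-enumerate : ∃ λ N → Coordinate ↔ Fin N
    Coordinate-enumerate with Subset-enumerate (suc d)
    ... | M , S↔M = #V ℕ.* M , ↔-trans (↔-refl ×-↔ S↔M) (↔-sym Fin.*↔×)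

    at : V → LinearForm (Subset (suc d)) → LinearForm Coordinate
    at v φ = pullback φ (λ x J → x (v , J)) (λ x≋y J → x≋y (v , J)) (λ _ _ _ _ → refl)

    -- The condition that J has d - 1 elements, expressed through ∁ J. In the right degree the
    -- equation is the zero form, so homogeneous maps are cut out by a system indexed by all
    -- coordinates.
    grading : Coordinate → LinearForm Coordinate
    grading (v , J) with ∣ ∁ J ∣ ℕ.≟ 2
    ... | yes _ = record { _·_ = λ _ → 0# ; ·-cong = λ _ → refl
                         ; linear = λ _ s _ → sym (trans (+-congˡ (zeroʳ s)) (+-identityʳ 0#)) }
    ... | no  _ = coordinate (v , J)

    grading-vanishes : ∀ x → (∀ v J → ∣ ∁ J ∣ ≢ 2 → x (v , J) ≈ 0#) → ∀ k → grading k · x ≈ 0#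
    grading-vanishes x graded (v , J) with ∣ ∁ J ∣ ℕ.≟ 2
    ... | yes _      = refl
    ... | no  ∣∁J∣≢2 = graded v J ∣∁J∣≢2

    -- The basis vectors `δ a` replace the infinitely many (q , 1), leaving a finite system;
    -- `Motions-pin` recovers arbitrary second arguments.
    pinning : Fin ρ × Fin (suc d) → LinearForm Coordinate
    pinning (r , a) = at (R r) (⟨⟩-form (homogenize (p° r) ∧ᵥ δ a))

    Motions : Subspace Coordinate
    Motions = full ⊓ grading ⊓ pinning

    motionsBasis : ∃ λ t → Basis Motions t
    motionsBasis = cut-finite (↔-sym Fin.*↔×)
      (proj₂ (cut-finite (proj₂ Coordinate-enumerate) (full-Basis (proj₂ Coordinate-enumerate)) grading)) pinning

    Motions-grade : ∀ {x} → Motions ∋ x → ∀ v J → ∣ ∁ J ∣ ≢ 2 → x (v , J) ≈ 0#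
    Motions-grade ((_ , graded) , _) v J ∣∁J∣≢2 with ∣ ∁ J ∣ ℕ.≟ 2 | graded (v , J)
    ... | yes ∣∁J∣≡2 | _   = contradiction ∣∁J∣≡2 ∣∁J∣≢2
    ... | no  _      | x≈0 = x≈0

    Motions-pin : ∀ {x} → Motions ∋ x → ∀ r w → ⟨ (λ J → x (R r , J)) , homogenize (p° r) ∧ᵥ w ⟩ ≈ 0#
    Motions-pin {x} (_ , pinned) r w = trans
      (·-decompose (standardBasis (suc d)) (⟨⟩-∧ᵥ-form (λ J → x (R r , J)) (homogenize (p° r))) w λ ())
      (sum-zero λ a → trans (*-congˡ (pinned (r , a))) (zeroʳ (δ a ∙ w)))

    -- Chosen so that `suc #bars` reduces to `suc d * d`, the number of ordered pairs of distinct
    -- axes; the form `suc _` is what `independent-transversal` asks for.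
    #bars : ℕ
    #bars = d′ ℕ.+ suc d′ ℕ.* suc d′

    axes : Fin (suc #bars) → Fin (suc d) × Fin (suc d)
    axes l = let (i , j) = remQuot {suc d} d l in i , punchIn i j

    axes-≢ : ∀ l → proj₁ (axes l) ≢ proj₂ (axes l)
    axes-≢ l = let (i , j) = remQuot {suc d} d l in Fin.punchInᵢ≢i i j ∘ ≡.sym

    axes-onto : ∀ i j → i ≢ j → ∃ λ l → axes l ≡ (i , j)
    axes-onto i j i≢j = combine i (punchOut i≢j) , ≡.trans
      (≡.cong (λ (i , j) → i , punchIn i j) (Fin.remQuot-combine {suc d} {d} i (punchOut i≢j)))
      (≡.cong (i ,_) (Fin.punchIn-punchOut i≢j))

    bar : Fin (suc #bars) → Λ (suc d)
    bar l = δ (proj₁ (axes l)) ∧ᵥ δ (proj₂ (axes l))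

    private module Standard = AdaptedBasis (standardBasis (suc d))

    bar≉0 : ∀ l → ¬ IsZero (bar l)
    bar≉0 l bar≈0 = 1≉0 (begin
      1#
        ≈⟨ trans (+-cong (*-identityʳ 1#) -0#≈0#) (+-identityʳ 1#) ⟨
      1# * 1# - 0#
        ≈⟨ +-cong (*-cong (Standard.f∙y-≡ i) (Standard.f∙y-≡ j))
                  (-‿cong (trans (*-congʳ (Standard.f∙y-≢ (axes-≢ l))) (zeroˡ _))) ⟨
      δ i ∙ δ i * δ j ∙ δ j - δ i ∙ δ j * δ j ∙ δ i
        ≈⟨ cauchy-binet (δ i) (δ j) (δ i) (δ j) ⟨
      inner (bar l) (bar l)
        ≈⟨ ·-zero (inner-form (bar l)) bar≈0 ⟩
      0# ∎)
      where
      i = proj₁ (axes l)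
      j = proj₂ (axes l)

    Bar : Fin (suc #bars) → Decomposable₂ (suc d)
    Bar l = record { bivector = bar l ; v₁ = δ (proj₁ (axes l)) ; v₂ = δ (proj₂ (axes l))
                   ; factors = λ _ → refl ; nonzero = bar≉0 l }

    barred : E → Fin (suc #bars) → LinearForm Coordinate
    barred i l = pullback (⟨⟩-form (bar l)) (λ x J → x (end₁ i , J) - x (end₂ i , J))
      (λ x≋y J → +-cong (x≋y _) (-‿cong (x≋y _)))
      (λ x s y J → solve 5 (λ a s a′ b b′ → (a :+ s :* a′) :- (b :+ s :* b′) := (a :- b) :+ s :* (a′ :- b′)) refl
        (x (end₁ i , J)) s (y (end₁ i , J)) (x (end₂ i , J)) (y (end₂ i , J)))

    -- The coordinate bivectors span all bivectors, so imposing every bar on an edge forces equal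
    -- motions at its two ends.
    vanishes-on-bars : ∀ (a : Λ (suc d)) → (∀ l → ⟨ a , bar l ⟩ ≈ 0#) → ∀ x y → ⟨ a , x ∧ᵥ y ⟩ ≈ 0#
    vanishes-on-bars a bars≈0 = form-vanishes (standardBasis (suc d)) a axes≈0 λ ()
      where
      axes≈0 : ∀ i j → ⟨ a , δ i ∧ᵥ δ j ⟩ ≈ 0#
      axes≈0 i j with i Fin.≟ j
      ... | yes ≡.refl = ⟨⟩-self a (δ i)
      ... | no  i≢j with axes-onto i j i≢j
      ... | l , ≡.refl = bars≈0 l

    module _ (F : Subset #E) where
      private
        module C = Components (components ends F ℓ₁)
        𝒫 : Partition #V
        𝒫 = C.components-partition
        open Partition 𝒫 using (size; part)
        module B X = AdaptedBasis (pinnedBasis R p° (part X))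
        module PairEnum X = Inverse (Pair-enumerate (B.t X))
        Unknowns↔ : Σ (Fin size) (Pair ∘ B.t) ↔ Fin (ℕSum.sum (triangle ∘ B.t))
        Unknowns↔ = Σ-enumerate λ X → Pair-enumerate (B.t X)

      -- The counting condition for the components of F bounds the freedom by the number of crossing
      -- edges, and an edge of F never crosses.
      freedom≤∣∁F∣ : ℕSum.sum (triangle ∘ B.t) ℕ.≤ ∣ ∁ F ∣
      freedom≤∣∁F∣ = ℕ.≤-trans
        (count-≤⁻ (triangle ∘ B.t) (λ X → if does (R_X≢∅? R (part X)) then pinRank d (pinnedDimension R p° (part X)) else 0)
          (λ X → ℕ.≤-reflexive (≡.sym (≡.trans (triangle≡C2 (suc d)) (pinned-rank R p° (part X)))))
          (count 𝒫 (λ X → pinnedDimension R p° (part X)) λ X → pinned-hasDimension R p° (part X)))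
        (∣filter∣≤∣∣ _ (λ i → i) (∁ F) λ i crosses → x∉p⇒x∈∁p (crosses ∘ C.joined))

      entry : Σ (Fin size) (Pair ∘ B.t) → LinearForm Coordinate
      entry (X , j , i) = at (C.rep X) (⟨⟩-form (B.y X (inject i) ∧ᵥ B.y X j))

      -- Such an x is constant on each component, so the pins of all vertices in the component
      -- restrict its value at the representative. What remains there is determined by the pairs
      -- y_i, y_j, whose values are the entries.
      constrained-trivial : ∀ x → Motions ⊓ constraints barred F ∋ x → (∀ k → entry k · x ≈ 0#) → x ≋ 𝟎
      constrained-trivial x (x∈ , x-F) entries≈0 (v , J) =
        trans (constant v (C.rep (C.label v)) (≡.sym (C.label∘rep (C.label v))) J) (rep-zero (C.label v) J)
        where
        _∼_ : V → V → Set ℓ₁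
        u ∼ w = ∀ J → x (u , J) ≈ x (w , J)
        ∼-isEquivalence : IsEquivalence _∼_
        ∼-isEquivalence = record
          { refl = λ _ → refl ; sym = λ p J → sym (p J) ; trans = λ p q J → trans (p J) (q J) }
        difference : E → Λ (suc d)
        difference i J = x (end₁ i , J) - x (end₂ i , J)
        difference-grade : ∀ i J → ∣ ∁ J ∣ ≢ 2 → difference i J ≈ 0#
        difference-grade i J ≢2 =
          trans (+-cong (Motions-grade {x} x∈ (end₁ i) J ≢2) (-‿cong (Motions-grade {x} x∈ (end₂ i) J ≢2))) (-‿inverseʳ 0#)
        joined : ∀ {i} → i ∈ F → end₁ i ∼ end₂ i
        joined {i} i∈F J = x-y≈0⇒x≈y (x (end₁ i , J)) (x (end₂ i , J)) (⟨⟩-nondegenerate (difference i)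
          (difference-grade i) (vanishes-on-bars (difference i) λ l → x-F ((i , i∈F) , l)) J)
        constant : ∀ u w → C.label u ≡ C.label w → u ∼ w
        constant = C.finest ∼-isEquivalence joined
        module _ (X : Fin size) where
          a : Λ (suc d)
          a J = x (C.rep X , J)
          rep-zero : a ≋ 𝟎
          rep-zero = ⟨⟩-nondegenerate a (Motions-grade {x} x∈ (C.rep X)) (form-vanishes (pinnedBasis R p° (part X)) a yy≈0 pin)
            where
            below : ∀ i j → toℕ i ℕ.< toℕ j → ⟨ a , B.y X i ∧ᵥ B.y X j ⟩ ≈ 0#
            below i j i<j = ≡.subst (λ i → ⟨ a , B.y X i ∧ᵥ B.y X j ⟩ ≈ 0#)
              (Fin.toℕ-injective (≡.trans (Fin.toℕ-inject (fromℕ< i<j)) (Fin.toℕ-fromℕ< i<j)))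
              (entries≈0 (X , j , fromℕ< i<j))
            yy≈0 : ∀ i j → ⟨ a , B.y X i ∧ᵥ B.y X j ⟩ ≈ 0#
            yy≈0 i j with Fin.<-cmp i j
            ... | tri< i<j _ _    = below i j i<j
            ... | tri≈ _ ≡.refl _ = ⟨⟩-self a (B.y X i)
            ... | tri> _ _ j<i    = trans (⟨⟩-antisym a (B.y X i) (B.y X j)) (trans (-‿cong (below j i j<i)) -0#≈0#)
            pin : ∀ l w → ⟨ a , homogenize (p° (B.σ X l)) ∧ᵥ w ⟩ ≈ 0#
            -- The pin belongs to the vertex `R (B.σ X l)` of the component; constancy carries its
            -- equation to the representative.
            pin l w = trans (·-cong (⟨⟩-form (homogenize (p° (B.σ X l)) ∧ᵥ w)) (constant (C.rep X) (R (B.σ X l))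
                (≡.trans (C.label∘rep X) (≡.sym (∈⇒partOf≡ 𝒫 (σ∈X R p° (part X) l))))))
              (Motions-pin {x} x∈ (B.σ X l) w)

      -- This is the hypothesis of `independent-transversal`: the entries form a system of at most
      -- |∁ F| equations with only the zero solution.
      few-constrained : ∀ s → Basis (Motions ⊓ constraints barred F) s → s ℕ.≤ ∣ ∁ F ∣
      few-constrained s B′ = ℕ.≤-trans
        (unknowns≤equations B′ (entry ∘ Inverse.from Unknowns↔) λ x x∈ entries≈0 →
          constrained-trivial x x∈ λ k → ≡.subst (λ k → entry k · x ≈ 0#)
            (Inverse.strictlyInverseʳ Unknowns↔ k) (entries≈0 (Inverse.to Unknowns↔ k)))
        freedom≤∣∁F∣

    transversal : ∃ λ (choice : E → Fin (suc #bars)) →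
      ∀ x → Motions ∋ x → (∀ i → barred i (choice i) · x ≈ 0#) → x ≋ 𝟎
    transversal = independent-transversal (proj₂ motionsBasis) barred few-constrained

    bars : E → Decomposable₂ (suc d)
    bars i = Bar (proj₁ transversal i)

    module _ (m : V → ⋀ (d ∸ 1) (suc d)) (infinitesimal : IsInfinitesimalMotion G R bars p° m) where

      coordinates : Coordinate → Carrier
      coordinates (v , J) = element (m v) J

      coordinates-graded : ∀ k → grading k · coordinates ≈ 0#
      coordinates-graded = grading-vanishes coordinates λ v J ∣∁J∣≢2 → homogeneous (m v) J (∣∁J∣≢2 ∘ ∣∁∣≡2 J)

      coordinates-pinned : ∀ k → pinning k · coordinates ≈ 0#
      coordinates-pinned (r , a) = ⟨⟩-vanishes-on-homogenize
        (element (m (R r))) (homogenize (p° r)) (proj₂ infinitesimal (R r) r ≡.refl) (δ a)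

      motion-zero : ∀ v → IsZero (element (m v))
      motion-zero v J = proj₂ transversal coordinates ((_ , coordinates-graded) , coordinates-pinned)
        (proj₁ infinitesimal) (v , J)

    count⇒rigid : ∃ λ (b : E → Setoid.Carrier (Gr₂ (suc d))) → InfinitesimallyRigid G R b p°
    count⇒rigid = bars , λ (m , infinitesimal , m≉0) → m≉0 (motion-zero m infinitesimal)

theorem6p3 : ∀ {c ℓ₁ ℓ₂} (ℝ : CompleteOrderedField c ℓ₁ ℓ₂) →
    let open Framework ℝ in
    ∀ (d : ℕ) .{{_ : NonZero d}} (G : Graph) (ρ : ℕ) (R : Fin ρ → Graph.V G) (p° : Fin ρ → Point d) →
    (∃ λ (b : Graph.E G → Setoid.Carrier (Gr₂ (suc d))) → InfinitesimallyRigid G R b p°)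
    ⇔ (∀ (𝒫 : Partition (Graph.#V G)) → CountingCondition G R p° 𝒫)
theorem6p3 ℝ zero G ρ R p° = contradiction ≡.refl (ℕ.≢-nonZero⁻¹ 0)
theorem6p3 ℝ (suc d′) G ρ R p° = mk⇔
  (λ (b , rigid) 𝒫 k dimension → Necessity.rigid⇒count G R p° 𝒫 k dimension b rigid)
  (Sufficiency.count⇒rigid G R p°)
  where open BodyBar ℝ
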